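{- Let $n\ge1$ and let $\mathcal{L}(n)$ be the set of all plane overpartitions (the empty one included) whose largest entry is at most $n$. Then $$\sum_{\Pi \in \mathcal{L}(n)}a^{o(\Pi)}q^{|\Pi|}=\prod_{j=1}^n \frac{\prod_{i=0}^n(1+aq^{i+j})}{\prod_{i=1}^{j}(1-q^{i+j-1})(1-a^2q^{i+j})}.$$
   Context: A plane overpartition is a filling of the Ferrers diagram of some partition with positive integers, weakly decreasing along each row (left to right) and each column (top to bottom), in which some entries are overlined subject to: (1) in each row, only the last (rightmost) occurrence of a given integer may be overlined; (2) in each column, the first (topmost) occurrence of a given integer may be overlined or not, and all other occurrences of that integer in the column are overlined. The value of an entry ignores the overline. $|\Pi|$ is the sum of all entries and $o(\Pi)$ the number of overlined entries. -}

module Defs where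

open import Data.Nat using (ℕ; zero; suc; _+_; _*_; _∸_; _≤ᵇ_; _≡ᵇ_)
open import Data.Bool using (Bool; true; false; _∧_; _∨_; not; if_then_else_; T)
open import Data.List using (List; []; _∷_; map; length; zip; upTo; foldr; null)
open import Data.Nat.ListAction using (sum)
open import Data.Maybe using (Maybe; just; nothing)
open import Data.Product using (Σ; _×_; _,_; proj₁; proj₂)
open import Relation.Binary.PropositionalEquality using (_≡_)

Entry : Set
Entry = ℕ × Bool

val : Entry → ℕ
val = proj₁

over : Entry → Bool
over = proj₂

-- A filling of a Ferrers diagram, given as its list of rows (top to bottom),
-- each row listed left to right.
Filling : Set
Filling = List (List Entry)

allᵇ : {A : Set} → (A → Bool) → List A → Bool
allᵇ p [] = true
allᵇ p (x ∷ xs) = p x ∧ allᵇ p xs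

elemᵇ : ℕ → List ℕ → Bool
elemᵇ x [] = false
elemᵇ x (y ∷ ys) = (x ≡ᵇ y) ∨ elemᵇ x ys

nth : {A : Set} → ℕ → List A → Maybe A
nth n [] = nothing
nth zero (x ∷ xs) = just x
nth (suc n) (x ∷ xs) = nth n xs

-- column j, read top to bottom (rows too short to reach column j are skipped;
-- by the shape condition these are exactly the bottom rows)
column : ℕ → Filling → List Entry
column j [] = []
column j (r ∷ rs) with nth j r
... | just e  = e ∷ column j rs
... | nothing = column j rs

width : Filling → ℕ
width [] = 0
width (r ∷ _) = length r

shapeOK : Filling → Bool
shapeOK [] = true
shapeOK (r ∷ []) = not (null r)
shapeOK (r ∷ s ∷ t) = not (null r) ∧ (length s ≤ᵇ length r) ∧ shapeOK (s ∷ t)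

positive : Filling → Bool
positive = allᵇ (allᵇ (λ e → 1 ≤ᵇ val e))

rowDecr : List Entry → Bool
rowDecr (x ∷ y ∷ r) = (val y ≤ᵇ val x) ∧ rowDecr (y ∷ r)
rowDecr _ = true

colDecr : Filling → Bool
colDecr (r ∷ s ∷ t) =
  allᵇ (λ p → val (proj₂ p) ≤ᵇ val (proj₁ p)) (zip r s) ∧ colDecr (s ∷ t)
colDecr _ = true

-- (1) in a row only the last (rightmost) occurrence of an integer may be
-- overlined: an overlined entry's value does not occur further right.
rowOverOK : List Entry → Bool
rowOverOK [] = true
rowOverOK (x ∷ r) = (not (over x) ∨ not (elemᵇ (val x) (map val r))) ∧ rowOverOK r

-- (2) in a column, every occurrence of an integer other than the topmost
-- one is overlined (the topmost is unconstrained).  'seen' = values above.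
colOverOK : List ℕ → List Entry → Bool
colOverOK seen [] = true
colOverOK seen (x ∷ r) = (not (elemᵇ (val x) seen) ∨ over x) ∧ colOverOK (val x ∷ seen) r

isPlaneOverpartition : Filling → Bool
isPlaneOverpartition Π =
  shapeOK Π ∧ positive Π ∧ allᵇ rowDecr Π ∧ colDecr Π ∧
  allᵇ rowOverOK Π ∧ allᵇ (λ j → colOverOK [] (column j Π)) (upTo (width Π))

weight : Filling → ℕ
weight Π = sum (map (λ r → sum (map val r)) Π)

overlines : Filling → ℕ
overlines Π = sum (map (λ r → sum (map (λ e → if over e then 1 else 0) r)) Π)

boundedBy : ℕ → Filling → Bool
boundedBy n = allᵇ (allᵇ (λ e → val e ≤ᵇ n))

L : ℕ → ℕ → ℕ → Set
L n m k = Σ Filling (λ Π →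
  T (isPlaneOverpartition Π) × T (boundedBy n Π) × overlines Π ≡ m × weight Π ≡ k)

-- Formal power series in a, q with ℕ coefficients:
-- S m k = coefficient of a^m q^k.

Series : Set
Series = ℕ → ℕ → ℕ

sumTo : ℕ → (ℕ → ℕ) → ℕ
sumTo zero f = f 0
sumTo (suc k) f = sumTo k f + f (suc k)

oneS : Series
oneS m k = if (m ≡ᵇ 0) ∧ (k ≡ᵇ 0) then 1 else 0

mono : ℕ → ℕ → Series
mono b e m k = if (m ≡ᵇ b) ∧ (k ≡ᵇ e) then 1 else 0

_⊕_ : Series → Series → Series
(f ⊕ g) m k = f m k + g m k

_⊛_ : Series → Series → Series
(f ⊛ g) m k = sumTo m (λ m₁ → sumTo k (λ k₁ → f m₁ k₁ * g (m ∸ m₁) (k ∸ k₁)))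

prodS : List Series → Series
prodS = foldr _⊛_ oneS

onePlus : ℕ → Series
onePlus e = oneS ⊕ mono 1 e

-- 1 / (1 - a^b q^e) = Σ_{t ≥ 0} a^{bt} q^{et}   (used only with e ≥ 1,
-- in which case only t ≤ k contribute to the coefficient of q^k)
geom : ℕ → ℕ → Series
geom b e m k = sumTo k (λ t → mono (b * t) (e * t) m k)

oneTo : ℕ → List ℕ
oneTo j = map suc (upTo j)

rhs : ℕ → Series
rhs n = prodS (map (λ j →
          prodS (map (λ i → onePlus (i + j)) (upTo (suc n))) ⊛
          prodS (map (λ i → geom 0 (i + j ∸ 1) ⊛ geom 2 (i + j)) (oneTo j)))
        (oneTo n))

{-# OPTIONS --safe #-}

-- Reading the cells of a plane overpartition by the order n, n̄, n−1, (n−1)‾, …, 1, 1̄ of their entries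
-- turns it into a chain of partitions in which non-overlined entries j add a horizontal strip
-- (weight q^j per cell) and overlined entries j̄ a vertical strip (weight a q^j per cell).  The
-- sum over all chains is evaluated as in Littlewood's identity for Σ_λ s_λ: the last strip, added to
-- μ, is reflected into a strip removed from μ, at the cost of a factor 1/(1 − x) for its weight x; the
-- removed strip then commutes past every earlier strip of weight y, at the cost of 1/(1 − x y) for
-- strips of the same kind and 1 + x y for strips of different kinds, until it reaches ∅.
--
-- Each step is a weight-preserving bijection obtained from a local rule: for fixed α and β, the γ
-- above both correspond to pairs of a number c and a δ below both with |γ| + |δ| = |α| + |β| + c.
-- For two horizontal strips, γ and δ are exchanged by γ_i = max(α_i, β_i) + c_i and
-- δ_i + c_{i+1} = min(α_i, β_i) with c_0 = c; for a mixed pair the same equations hold, except that a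
-- row with β_i < α_i forces γ_i = α_i and δ_i = β_i and transmits the carry, c_i = c_{i+1}; two
-- vertical strips are the conjugate case of two horizontal ones.
--
-- Finally 1/(1 − a q^j) = (1 + a q^j)/(1 − a² q^{2j}) puts the product into the stated shape.
module Submission where

open import Algebra.Bundles using (CommutativeMonoid)
import Algebra.Solver.CommutativeMonoid as CommutativeMonoidSolver
open import Axiom.UniquenessOfIdentityProofs using (module Decidable⇒UIP)
open import Data.Bool using (Bool; true; false; T; T?; not; _∧_; _∨_; if_then_else_)
import Data.Bool.Properties as Bool
open import Data.Bool.Properties using (T-∧; T-∨; T-≡; T-irrelevant)
open import Data.Fin using (Fin; zero; suc)
open import Data.Fin.Properties using (+↔⊎; *↔×)
open import Data.Irrelevant using (Irrelevant; [_])
open import Data.List using (List; []; _∷_; _∷ʳ_; _++_; length; map; foldr; replicate; zip; null; upTo)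
open import Data.List.Membership.Propositional using (_∈_)
open import Data.List.Membership.Propositional.Properties using (∈-map⁺; ∈-map⁻; ∈-upTo⁺; ∈-upTo⁻)
open import Data.List.Properties
  using (length-++; length-replicate; map-++; map-replicate; map-upTo; applyUpTo-∷ʳ; ≡-dec)
open import Data.List.Relation.Unary.All as All using (All; []; _∷_)
open import Data.List.Relation.Unary.All.Properties using (map⁺)
open import Data.List.Relation.Unary.AllPairs using (AllPairs; []; _∷_)
open import Data.List.Relation.Unary.AllPairs.Properties using (applyUpTo⁺₁)
open import Data.List.Relation.Unary.Any using (here; there)
open import Data.Maybe using (just; nothing)
open import Data.Nat
open import Data.Nat.DivMod using (_/_; _%_; m%n<n; m≡m%n+[m/n]*n; [m+kn]%n≡m%n; m<n⇒m%n≡m)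
open import Data.Nat.ListAction using (sum)
open import Data.Nat.ListAction.Properties using (sum-++)
open import Data.Nat.Properties
open import Data.Nat.Solver using (module +-*-Solver)
open import Data.Product using (Σ; ∃; _×_; _,_; proj₁; proj₂; swap)
open import Data.Product.Function.NonDependent.Propositional using (_×-↔_)
import Data.Product.Properties as Product
open import Data.Refinement using (Refinement; _,_; value)
open import Data.Sum using (_⊎_; inj₁; inj₂; [_,_]′)
open import Data.Sum.Function.Propositional using (_⊎-↔_)
open import Data.Unit using (⊤; tt)
open import Function.Base using (_∘_; id; _$_)
open import Function.Bundles using (_↔_; mk↔ₛ′; Inverse; Equivalence)
open import Function.Properties.Inverse using (↔-trans)
open import Level using (0ℓ) renaming (suc to lsuc)
open import Relation.Binary.Definitions using (DecidableEquality)
open import Relation.Binary.PropositionalEquality hiding ([_])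
import Relation.Binary.Reasoning.Setoid as SetoidReasoning
open import Relation.Nullary using (Dec; yes; no; ¬_; recompute; contradiction)
open import Relation.Nullary.Decidable using (¬?)
open import Defs

-- Weighted classes

-- A `Class` stands for a power series: a weight is a pair of exponents, of a and of q, the product
-- is `⊗`, and `≅` takes the place of equality. Sums over all partitions then raise no question of
-- convergence, and numbers appear only when coefficients are matched with fibers.
--
-- The strip picture rests on an asymmetry between j and j̄. In a row j̄ comes after every j, and at
-- most once; in a column j comes before every j̄, and at most once. Both conditions put j before
-- j̄, so one order of letters serves rows and columns alike.
--
-- A local rule is a system of row equations linked by carries. Given c and δ it is solved from the
-- top row down, given γ from the bottom row up; each solution is unique, and this makes the two
-- maps inverse to each other. In a mixed pair some rows leave γ and δ no freedom at all, and these
-- are the rows which a carry has to pass unchanged.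
--
-- Strip and tableau conditions are kept as irrelevant proofs, so that bijections are compared on
-- their data alone; where such a proof is needed it is recomputed from decidability.

Weight : Set
Weight = ℕ × ℕ

infixl 6 _+ʷ_
_+ʷ_ : Weight → Weight → Weight
(b , e) +ʷ (b′ , e′) = (b + b′ , e + e′)

0ʷ : Weight
0ʷ = (0 , 0)

infixl 7 _·ʷ_
_·ʷ_ : Weight → ℕ → Weight
(b , e) ·ʷ s = (b * s , e * s)

+ʷ-commutativeMonoid : CommutativeMonoid 0ℓ 0ℓ
+ʷ-commutativeMonoid = record
  { Carrier = Weight ; _≈_ = _≡_ ; _∙_ = _+ʷ_ ; ε = 0ʷ
  ; isCommutativeMonoid = record
    { isMonoid = record
      { isSemigroup = record
        { isMagma = record { isEquivalence = isEquivalence ; ∙-cong = cong₂ _+ʷ_ }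
        ; assoc = λ (a , b) (c , d) (e , f) → cong₂ _,_ (+-assoc a c e) (+-assoc b d f) }
      ; identity = (λ _ → refl)
                 , λ (a , b) → cong₂ _,_ (+-identityʳ a) (+-identityʳ b) }
    ; comm = λ (a , b) (c , d) → cong₂ _,_ (+-comm a c) (+-comm b d) } }

open CommutativeMonoid +ʷ-commutativeMonoid public using () renaming
  (assoc to +ʷ-assoc; comm to +ʷ-comm; identityʳ to +ʷ-identityʳ)

·ʷ-zeroʳ : ∀ u → u ·ʷ 0 ≡ 0ʷ
·ʷ-zeroʳ (b , e) = cong₂ _,_ (*-zeroʳ b) (*-zeroʳ e)

·ʷ-distribˡ : ∀ u s t → u ·ʷ (s + t) ≡ u ·ʷ s +ʷ u ·ʷ t
·ʷ-distribˡ (b , e) s t = cong₂ _,_ (*-distribˡ-+ b s t) (*-distribˡ-+ e s t)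

·ʷ-distribʳ : ∀ s u v → (u +ʷ v) ·ʷ s ≡ u ·ʷ s +ʷ v ·ʷ s
·ʷ-distribʳ s (b , e) (b′ , e′) = cong₂ _,_ (*-distribʳ-+ s b b′) (*-distribʳ-+ s e e′)

record Class : Set₁ where
  constructor class
  field
    Carrier : Set
    wt      : Carrier → Weight
open Class public

infix 4 _≅_
record _≅_ (X Y : Class) : Set where
  constructor iso
  field
    to      : Carrier X → Carrier Y
    from    : Carrier Y → Carrier X
    to-from : ∀ y → to (from y) ≡ y
    from-to : ∀ x → from (to x) ≡ x
    wt-to   : ∀ x → wt Y (to x) ≡ wt X x

≅-refl : ∀ {X} → X ≅ X
≅-refl = iso id id (λ _ → refl) (λ _ → refl) (λ _ → refl)

≅-sym : ∀ {X Y} → X ≅ Y → Y ≅ X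
≅-sym {X} {Y} (iso f g fg gf w) =
  iso g f gf fg λ y → trans (sym (w (g y))) (cong (wt Y) (fg y))

≅-trans : ∀ {X Y Z} → X ≅ Y → Y ≅ Z → X ≅ Z
≅-trans (iso f g fg gf w) (iso f′ g′ fg′ gf′ w′) = iso (f′ ∘ f) (g ∘ g′)
  (λ z → trans (cong f′ (fg (g′ z))) (fg′ z))
  (λ x → trans (cong g (gf′ (f x))) (gf x))
  (λ x → trans (w′ (f x)) (w x))

𝟙 : Class
𝟙 = class ⊤ (λ _ → 0ʷ)

infixr 7 _⊗_
_⊗_ : Class → Class → Class
X ⊗ Y = class (Carrier X × Carrier Y) (λ (x , y) → wt X x +ʷ wt Y y)

⊗-cong : ∀ {X X′ Y Y′} → X ≅ X′ → Y ≅ Y′ → X ⊗ Y ≅ X′ ⊗ Y′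
⊗-cong (iso f g fg gf w) (iso f′ g′ fg′ gf′ w′) = iso
  (λ (x , y) → f x , f′ y) (λ (x , y) → g x , g′ y)
  (λ (x , y) → cong₂ _,_ (fg x) (fg′ y)) (λ (x , y) → cong₂ _,_ (gf x) (gf′ y))
  (λ (x , y) → cong₂ _+ʷ_ (w x) (w′ y))

⊗-congʳ : ∀ X {Y Y′} → Y ≅ Y′ → X ⊗ Y ≅ X ⊗ Y′
⊗-congʳ X h = ⊗-cong (≅-refl {X}) h

⊗-commutativeMonoid : CommutativeMonoid (lsuc 0ℓ) 0ℓ
⊗-commutativeMonoid = record
  { Carrier = Class ; _≈_ = _≅_ ; _∙_ = _⊗_ ; ε = 𝟙
  ; isCommutativeMonoid = record
    { isMonoid = record
      { isSemigroup = record
        { isMagma = record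
          { isEquivalence = record { refl = ≅-refl ; sym = ≅-sym ; trans = ≅-trans }
          ; ∙-cong = ⊗-cong }
        ; assoc = λ X Y Z → iso (λ ((x , y) , z) → x , y , z) (λ (x , y , z) → (x , y) , z)
            (λ _ → refl) (λ _ → refl)
            (λ ((x , y) , z) → sym (+ʷ-assoc (wt X x) (wt Y y) (wt Z z))) }
      ; identity = (λ X → iso proj₂ (λ x → tt , x) (λ _ → refl) (λ _ → refl) (λ _ → refl))
                 , λ X → iso proj₁ (λ x → x , tt) (λ _ → refl) (λ _ → refl)
                     (λ (x , _) → sym (+ʷ-identityʳ (wt X x))) }
    ; comm = λ X Y → iso (λ (x , y) → y , x) (λ (y , x) → x , y) (λ _ → refl) (λ _ → refl)
        (λ (x , y) → +ʷ-comm (wt Y y) (wt X x)) } }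

⨆ : (A : Set) → (A → Class) → Class
⨆ A F = class (Σ A (λ a → Carrier (F a))) (λ (a , x) → wt (F a) x)

syntax ⨆ A (λ a → F) = ⨆[ a ∈ A ] F

⨆-cong : ∀ {A F G} → (∀ a → F a ≅ G a) → ⨆ A F ≅ ⨆ A G
⨆-cong h = iso (λ (a , x) → a , to (h a) x) (λ (a , x) → a , from (h a) x)
  (λ (a , x) → cong (a ,_) (to-from (h a) x)) (λ (a , x) → cong (a ,_) (from-to (h a) x))
  (λ (a , x) → wt-to (h a) x)
  where open _≅_

module ⊗ = CommutativeMonoid ⊗-commutativeMonoid
module ⊗-Solver = CommutativeMonoidSolver ⊗-commutativeMonoid
module +ʷ-Solver = CommutativeMonoidSolver +ʷ-commutativeMonoid

-- Partitions

at : {A : Set} → A → List A → ℕ → A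
at d []       i       = d
at d (x ∷ xs) zero    = x
at d (x ∷ xs) (suc i) = at d xs i

at-≥length : {A : Set} {d : A} (xs : List A) {i : ℕ} → length xs ≤ i → at d xs i ≡ d
at-≥length []       _       = refl
at-≥length (x ∷ xs) (s≤s l) = at-≥length xs l

-- Lists without the default value correspond to functions that reach the default and then stay
-- there, so lists can be compared at every index without bounds. The general form serves twice:
-- with 0 for partitions and with the empty row for fillings.
module FiniteSupport {A : Set} (d : A) (_≟d : (a : A) → Dec (a ≡ d)) where

  Proper : List A → Set
  Proper = All (_≢ d)

  at-ext : ∀ {xs ys} → Proper xs → Proper ys → (∀ i → at d xs i ≡ at d ys i) → xs ≡ ys
  at-ext []       []       h = refl
  at-ext []       (y ∷ ys) h = contradiction (sym (h 0)) y
  at-ext (x ∷ xs) []       h = contradiction (h 0) x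
  at-ext (x ∷ xs) (y ∷ ys) h = cong₂ _∷_ (h 0) (at-ext xs ys (h ∘ suc))

  build : ℕ → (ℕ → A) → List A
  build zero    f = []
  build (suc N) f with f 0 ≟d
  ... | yes _ = []
  ... | no  _ = f 0 ∷ build N (f ∘ suc)

  build-proper : ∀ N f → Proper (build N f)
  build-proper zero    f = []
  build-proper (suc N) f with f 0 ≟d
  ... | yes _ = []
  ... | no  p = p ∷ build-proper N (f ∘ suc)

  Vanishing : (ℕ → A) → Set
  Vanishing f = ∀ i → f i ≡ d → f (suc i) ≡ d

  vanishes-from-0 : ∀ {f} → Vanishing f → f 0 ≡ d → ∀ i → f i ≡ d
  vanishes-from-0 v z zero    = z
  vanishes-from-0 v z (suc i) = v i (vanishes-from-0 v z i)

  at-build : ∀ N f → Vanishing f → f N ≡ d → ∀ i → at d (build N f) i ≡ f i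
  at-build zero    f v z i = sym (vanishes-from-0 v z i)
  at-build (suc N) f v z i with f 0 ≟d
  at-build (suc N) f v z i       | yes p = sym (vanishes-from-0 v p i)
  at-build (suc N) f v z zero    | no  _ = refl
  at-build (suc N) f v z (suc i) | no  _ = at-build N (f ∘ suc) (v ∘ suc) z i

  at-proper : ∀ {xs i} → Proper xs → i < length xs → at d xs i ≢ d
  at-proper {i = zero}  (p ∷ ps) l       = p
  at-proper {i = suc i} (p ∷ ps) (s≤s l) = at-proper ps l

open FiniteSupport 0 (_≟ 0)

Decreasing : (ℕ → ℕ) → Set
Decreasing f = ∀ i → f (suc i) ≤ f i

-- The properties are irrelevant, so partitions with the same parts are equal. Each single
-- inequality is decidable and can be recomputed where it is used.
record Partition : Set where
  constructor partition
  field
    parts  : List ℕ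
    .proper : Proper parts
    .decr  : Decreasing (at 0 parts)

open Partition public using (parts)

row : Partition → ℕ → ℕ
row p = at 0 (parts p)

row-decr : ∀ p → Decreasing (row p)
row-decr (partition xs _ d) i = recompute (_ ≤? _) (d i)

partition-≡ : ∀ {p q} → parts p ≡ parts q → p ≡ q
partition-≡ refl = refl

proper? : ∀ xs → Dec (Proper xs)
proper? = Data.List.Relation.Unary.All.all? (λ x → ¬? (x ≟ 0))
  where import Data.List.Relation.Unary.All

row-ext : ∀ p q → (∀ i → row p i ≡ row q i) → p ≡ q
row-ext (partition xs p _) (partition ys q _) h =
  partition-≡ (at-ext (recompute (proper? xs) p) (recompute (proper? ys) q) h)

decr⇒vanishing : ∀ {f} → Decreasing f → Vanishing f
decr⇒vanishing {f} d i z = n≤0⇒n≡0 (subst (f (suc i) ≤_) z (d i))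

fromRows : ∀ N (f : ℕ → ℕ) → .(Decreasing f) → .(f N ≡ 0) → Partition
fromRows N f d z = partition (build N f) (build-proper N f)
  λ i → subst₂ _≤_ (sym (at-build N f (decr⇒vanishing d) z (suc i)))
                   (sym (at-build N f (decr⇒vanishing d) z i)) (d i)

row-fromRows : ∀ N f .(d : Decreasing f) .(z : f N ≡ 0) i → row (fromRows N f d z) i ≡ f i
row-fromRows N f d z i = recompute (_ ≟ _) (at-build N f (decr⇒vanishing d) z i)

∅ : Partition
∅ = partition [] [] λ _ → z≤n

size : Partition → ℕ
size p = sum (parts p)

len : Partition → ℕ
len p = length (parts p)

row-≥len : ∀ p {i} → len p ≤ i → row p i ≡ 0
row-≥len p = at-≥length (parts p)

Σ< : ℕ → (ℕ → ℕ) → ℕ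
Σ< zero    f = 0
Σ< (suc N) f = f 0 + Σ< N (f ∘ suc)

Σ<-cong : ∀ N {f g : ℕ → ℕ} → (∀ i → f i ≡ g i) → Σ< N f ≡ Σ< N g
Σ<-cong zero    h = refl
Σ<-cong (suc N) h = cong₂ _+_ (h 0) (Σ<-cong N (h ∘ suc))

sum-at : ∀ xs {N} → length xs ≤ N → sum xs ≡ Σ< N (at 0 xs)
sum-at []       {zero}  _       = refl
sum-at []       {suc N} _       = sum-at [] {N} z≤n
sum-at (x ∷ xs) {suc N} (s≤s l) = cong (x +_) (sum-at xs l)

size-Σ : ∀ p {N} → len p ≤ N → size p ≡ Σ< N (row p)
size-Σ p = sum-at (parts p)

length-build : ∀ N f → length (build N f) ≤ N
length-build zero    f = z≤n
length-build (suc N) f with f 0 ≟ 0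
... | yes _ = z≤n
... | no  _ = s≤s (length-build N (f ∘ suc))

-- Local rules

refinement-≡ : {A : Set} {P : A → Set} {x y : Refinement A P} → value x ≡ value y → x ≡ y
refinement-≡ refl = refl

-- One row of a local rule: c and c′ are the carries entering and leaving the row.
data Step : Bool → (M m c c′ d g : ℕ) → Set where
  pass : ∀ {M m c c′ d g} → d ≡ m → g ≡ M → c ≡ c′ → Step true M m c c′ d g
  turn : ∀ {M m c c′ d g} → d + c′ ≡ m → g ≡ M + c → Step false M m c c′ d g

-- A row determines what leaves it in either direction, here and in `step-↓-unique`. The inverse
-- laws of the local rules come from this uniqueness instead of a computation of one map after the
-- other.
step-↑-unique : ∀ {e M m c c₁ c₂ d g₁ g₂} →
  Step e M m c c₁ d g₁ → Step e M m c c₂ d g₂ → c₁ ≡ c₂ × g₁ ≡ g₂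
step-↑-unique (pass _ p q) (pass _ p′ q′) = trans (sym q) q′ , trans p (sym p′)
step-↑-unique {d = d} (turn p q) (turn p′ q′) =
  +-cancelˡ-≡ d _ _ (trans p (sym p′)) , trans q (sym q′)

step-↓-unique : ∀ {e M m c₁ c₂ c′ d₁ d₂ g} →
  Step e M m c₁ c′ d₁ g → Step e M m c₂ c′ d₂ g → c₁ ≡ c₂ × d₁ ≡ d₂
step-↓-unique (pass r _ q) (pass r′ _ q′) = trans q (sym q′) , trans r (sym r′)
step-↓-unique {M = M} {c′ = c′} (turn p q) (turn p′ q′) =
  +-cancelˡ-≡ M _ _ (trans (sym q) q′) , +-cancelʳ-≡ c′ _ _ (trans p (sym p′))

step-sum : ∀ {e M m c c′ d g} → Step e M m c c′ d g → g + d + c′ ≡ (M + m) + c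
step-sum (pass refl refl refl) = refl
step-sum {M = M} {c = c} {c′} {d} (turn refl refl) =
  solve 4 (λ M c c′ d → (M :+ c) :+ d :+ c′ := (M :+ (d :+ c′)) :+ c) refl M c c′ d
  where open +-*-Solver

Below : Bool → ℕ → ℕ → Set
Below true  x y = x ≡ y
Below false x y = x ≤ y

module Carries (E : ℕ → Bool) (M m : ℕ → ℕ) where

  Coupled : (c D G : ℕ → ℕ) → Set
  Coupled c D G = ∀ i → Step (E i) (M i) (m i) (c i) (c (suc i)) (D i) (G i)

  coupled-↑-unique : ∀ {c c′ D G G′} → Coupled c D G → Coupled c′ D G′ → c 0 ≡ c′ 0 →
    ∀ i → c i ≡ c′ i × G i ≡ G′ i
  coupled-↑-unique {c} {c′} {D} {G} {G′} k k′ c₀ i = c≡ i , G≡ (c≡ i)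
    where
    same : ∀ {i} → c i ≡ c′ i → c (suc i) ≡ c′ (suc i) × G i ≡ G′ i
    same {i} e = step-↑-unique (k i)
      (subst (λ x → Step (E i) (M i) (m i) x (c′ (suc i)) (D i) (G′ i)) (sym e) (k′ i))
    G≡ : ∀ {i} → c i ≡ c′ i → G i ≡ G′ i
    G≡ e = proj₂ (same e)
    c≡ : ∀ i → c i ≡ c′ i
    c≡ zero    = c₀
    c≡ (suc i) = proj₁ (same (c≡ i))

  -- Each row preserves the number of cells up to the difference of its two carries (`step-sum`), so
  -- the sum telescopes to the first and the last carry.
  coupled-sum : ∀ {c D G} → Coupled c D G → ∀ N →
    Σ< N G + Σ< N D + c N ≡ Σ< N (λ i → M i + m i) + c 0
  coupled-sum {c} {D} {G} k = go E M m c D G k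
    where
    open +-*-Solver
    open ≡-Reasoning
    go : ∀ E M m c D G → (∀ i → Step (E i) (M i) (m i) (c i) (c (suc i)) (D i) (G i)) → ∀ N →
      Σ< N G + Σ< N D + c N ≡ Σ< N (λ i → M i + m i) + c 0
    go E M m c D G k zero    = refl
    go E M m c D G k (suc N) = begin
      (G 0 + g) + (D 0 + d) + c (suc N)
        ≡⟨ solve 5 (λ G₀ g D₀ d c → (G₀ :+ g) :+ (D₀ :+ d) :+ c := G₀ :+ D₀ :+ (g :+ d :+ c))
             refl (G 0) g (D 0) d (c (suc N)) ⟩
      G 0 + D 0 + (g + d + c (suc N))
        ≡⟨ cong (G 0 + D 0 +_) (go _ _ _ _ _ _ (k ∘ suc) N) ⟩
      G 0 + D 0 + (s + c 1)
        ≡⟨ solve 4 (λ G₀ D₀ s c → G₀ :+ D₀ :+ (s :+ c) := (G₀ :+ D₀ :+ c) :+ s)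
             refl (G 0) (D 0) s (c 1) ⟩
      (G 0 + D 0 + c 1) + s
        ≡⟨ cong (_+ s) (step-sum (k 0)) ⟩
      (M 0 + m 0 + c 0) + s
        ≡⟨ solve 3 (λ x c s → (x :+ c) :+ s := (x :+ s) :+ c) refl (M 0 + m 0) (c 0) s ⟩
      (M 0 + m 0 + s) + c 0 ∎
      where
      g = Σ< N (G ∘ suc)
      d = Σ< N (D ∘ suc)
      s = Σ< N (λ i → M (suc i) + m (suc i))

  nextCarry : Bool → (m c d : ℕ) → ℕ
  nextCarry true  m c d = c
  nextCarry false m c d = m ∸ d

  prevCarry : Bool → (M c′ g : ℕ) → ℕ
  prevCarry true  M c′ g = c′
  prevCarry false M c′ g = g ∸ M

  raise : Bool → (M c : ℕ) → ℕ
  raise true  M c = M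
  raise false M c = M + c

  lower : Bool → (m c′ : ℕ) → ℕ
  lower true  m c′ = m
  lower false m c′ = m ∸ c′

  carry↑ : ℕ → (ℕ → ℕ) → ℕ → ℕ
  carry↑ k D zero    = k
  carry↑ k D (suc i) = nextCarry (E i) (m i) (carry↑ k D i) (D i)

  rows↑ : ℕ → (ℕ → ℕ) → ℕ → ℕ
  rows↑ k D i = raise (E i) (M i) (carry↑ k D i)

  coupled-↑ : ∀ k D → (∀ i → Below (E i) (D i) (m i)) → Coupled (carry↑ k D) D (rows↑ k D)
  coupled-↑ k D h i = go (E i) (h i)
    where
    go : ∀ e → Below e (D i) (m i) → Step e (M i) (m i) (carry↑ k D i)
      (nextCarry e (m i) (carry↑ k D i) (D i)) (D i) (raise e (M i) (carry↑ k D i))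
    go true  p = pass p refl refl
    go false p = turn (m+[n∸m]≡n p) refl

  module Support (N : ℕ) (E≡false : ∀ {i} → N ≤ i → E i ≡ false)
    (M≡0 : ∀ {i} → N ≤ i → M i ≡ 0) (m≡0 : ∀ {i} → N ≤ i → m i ≡ 0) where

    -- Beyond the support a row turns and `d + c′ = m = 0`. This gives the solution from below a
    -- place to start.
    coupled-tail : ∀ {c D G} → Coupled c D G → ∀ {i} → N ≤ i → c (suc i) ≡ 0
    coupled-tail {c} {D} k {i} l = go (E≡false l) (k i)
      where
      go : ∀ {e g} → e ≡ false → Step e (M i) (m i) (c i) (c (suc i)) (D i) g → c (suc i) ≡ 0
      go refl (turn p _) = m+n≡0⇒n≡0 (D i) (trans p (m≡0 l))

    coupled-↓-unique : ∀ {c c′ D D′ G} → Coupled c D G → Coupled c′ D′ G →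
      ∀ i → c i ≡ c′ i × D i ≡ D′ i
    coupled-↓-unique {c} {c′} {D} {D′} {G} k k′ i =
      c≡ N i (m≤n+m N i) , proj₂ (same (c≡ N (suc i) (m≤n+m N (suc i))))
      where
      same : ∀ {i} → c (suc i) ≡ c′ (suc i) → c i ≡ c′ i × D i ≡ D′ i
      same {i} e = step-↓-unique (k i)
        (subst (λ x → Step (E i) (M i) (m i) (c′ i) x (D′ i) (G i)) (sym e) (k′ i))
      c≡ : ∀ j i → N ≤ i + j → c i ≡ c′ i
      c≡ zero    i l =
        let l′ = subst (N ≤_) (+-identityʳ i) l
        in proj₁ (same (trans (coupled-tail k l′) (sym (coupled-tail k′ l′))))
      c≡ (suc j) i l = proj₁ (same (c≡ j (suc i) (subst (N ≤_) (+-suc i j) l)))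

    fuelled : (ℕ → ℕ) → (fuel i : ℕ) → ℕ
    -- With `N ∸ i` as fuel this is the carry at a row past the support, where `G` and `M` vanish
    -- and no row passes.
    fuelled G zero    i = 0
    fuelled G (suc f) i = prevCarry (E i) (M i) (fuelled G f (suc i)) (G i)

    carry↓ : (ℕ → ℕ) → ℕ → ℕ
    carry↓ G i = fuelled G (N ∸ i) i

    rows↓ : (ℕ → ℕ) → ℕ → ℕ
    rows↓ G i = lower (E i) (m i) (carry↓ G (suc i))

    carry↓-≥ : ∀ G {i} → N ≤ i → carry↓ G i ≡ 0
    carry↓-≥ G {i} l rewrite m≤n⇒m∸n≡0 l = refl

    carry↓-< : ∀ G {i} → i < N →
      carry↓ G i ≡ prevCarry (E i) (M i) (carry↓ G (suc i)) (G i)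
    carry↓-< G {i} l rewrite +-∸-assoc 1 l = refl

    carry↓-step : ∀ G → (∀ {i} → N ≤ i → G i ≡ 0) → ∀ i →
      carry↓ G i ≡ prevCarry (E i) (M i) (carry↓ G (suc i)) (G i)
    carry↓-step G z i with i <? N
    ... | yes l = carry↓-< G l
    ... | no  l = let l′ = ≮⇒≥ l in trans (carry↓-≥ G l′) (go (E≡false l′) (z l′))
      where
      go : ∀ {e c g} → e ≡ false → g ≡ 0 → 0 ≡ prevCarry e (M i) c g
      go refl refl = sym (0∸n≡0 (M i))

    -- The last hypothesis makes the truncated subtraction in `lower` exact; the others do the same
    -- for `prevCarry` and for the passing rows.
    coupled-↓ : ∀ G → (∀ {i} → N ≤ i → G i ≡ 0) → (∀ i → Below (E i) (M i) (G i)) →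
      (∀ i → E i ≡ false → carry↓ G (suc i) ≤ m i) → Coupled (carry↓ G) (rows↓ G) G
    coupled-↓ G z h l i = go (E i) (h i) (l i) (carry↓-step G z i)
      where
      c′ = carry↓ G (suc i)
      go : ∀ e → Below e (M i) (G i) → (e ≡ false → c′ ≤ m i) → ∀ {c} →
        c ≡ prevCarry e (M i) c′ (G i) → Step e (M i) (m i) c c′ (lower e (m i) c′) (G i)
      go true  p _ q = pass refl (sym p) q
      go false p l q = turn (m∸n+n≡m (l refl)) (sym (trans (cong (M i +_) q) (m+[n∸m]≡n p)))

-- In every instance α and β are fixed, γ ranges over the corners above both, δ over the corners
-- below both, and n = |α| + |β|.
record LocalRule (Q : ℕ → Set) (Up Dn : Partition → Set) (n : ℕ) : Set where
  field
    to      : Refinement Partition Up → Refinement ℕ Q × Refinement Partition Dn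
    from    : Refinement ℕ Q × Refinement Partition Dn → Refinement Partition Up
    to-from : ∀ y → to (from y) ≡ y
    from-to : ∀ x → from (to x) ≡ x
    sizes   : ∀ x → size (value x) + size (value (proj₂ (to x))) ≡ n + value (proj₁ (to x))

-- What has to be checked for each kind of square. `up-turn` and `up-pass` ensure that the carry
-- coming from row `i + 1` fits into `m i`: it is either the excess of that row, or a carry handed
-- on from further below, of which only `Q` is known. `up-ok` and `dn-ok` transport the strip
-- conditions across the row equations.
record CarryRule (E : ℕ → Bool) (M m : ℕ → ℕ) (N : ℕ)
                 (Q : ℕ → Set) (Up Dn : (ℕ → ℕ) → Set) : Set where
  open Carries E M m
  field
    E≡false : ∀ {i} → N ≤ i → E i ≡ false
    M≡0     : ∀ {i} → N ≤ i → M i ≡ 0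
    m≡0     : ∀ {i} → N ≤ i → m i ≡ 0
    Q-zero  : Q 0

    up-recompute : ∀ {G} → .(Up G) → Up G
    up-resp      : ∀ {G G′} → (∀ i → G i ≡ G′ i) → Up G → Up G′
    up-decr      : ∀ {G} → Up G → Decreasing G
    up-support   : ∀ {G} → Up G → ∀ {i} → N ≤ i → G i ≡ 0
    up-below     : ∀ {G} → Up G → ∀ i → Below (E i) (M i) (G i)
    up-carry     : ∀ {G} → Up G → ∀ i → E i ≡ false → Q (G i ∸ M i)
    up-turn      : ∀ {G} → Up G → ∀ i → E i ≡ false → E (suc i) ≡ false → G (suc i) ∸ M (suc i) ≤ m i
    up-pass      : ∀ {G} → Up G → ∀ i → E i ≡ false → E (suc i) ≡ true → ∀ {c} → Q c → c ≤ m i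
    up-ok        : ∀ {c D G} → Dn D → (∀ i → Q (c i)) → Coupled c D G → Up G

    dn-recompute : ∀ {D} → .(Dn D) → Dn D
    dn-resp      : ∀ {D D′} → (∀ i → D i ≡ D′ i) → Dn D → Dn D′
    dn-decr      : ∀ {D} → Dn D → Decreasing D
    dn-below     : ∀ {D} → Dn D → ∀ i → Below (E i) (D i) (m i)
    dn-carry     : ∀ {D} → Dn D → ∀ i → E i ≡ false → Q (m i ∸ D i)
    dn-ok        : ∀ {c D G} → Up G → (∀ i → Q (c i)) → Coupled c D G → Dn D

  open Support N E≡false M≡0 m≡0

  Q-carry↑ : ∀ {k D} → Q k → Dn D → ∀ i → Q (carry↑ k D i)
  Q-carry↑ q d zero    = q
  Q-carry↑ {k} {D} q d (suc i) = go (E i) (dn-carry d i) (Q-carry↑ q d i)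
    where
    go : ∀ e → (e ≡ false → Q (m i ∸ D i)) → ∀ {c} → Q c → Q (nextCarry e (m i) c (D i))
    go true  _ q′ = q′
    go false h _  = h refl

  Q-carry↓ : ∀ {G} → Up G → ∀ i → Q (carry↓ G i)
  Q-carry↓ {G} u i = fuel (N ∸ i) i
    where
    go : ∀ e i → (e ≡ false → Q (G i ∸ M i)) → ∀ {c} → Q c → Q (prevCarry e (M i) c (G i))
    go true  i _ q′ = q′
    go false i h _  = h refl
    fuel : ∀ f i → Q (fuelled G f i)
    fuel zero    i = Q-zero
    fuel (suc f) i = go (E i) i (up-carry u i) (fuel f (suc i))

  up-coupled : ∀ {k D} → Dn D → Coupled (carry↑ k D) D (rows↑ k D)
  up-coupled d = coupled-↑ _ _ (dn-below d)

  dn-coupled : ∀ {G} → Up G → Coupled (carry↓ G) (rows↓ G) G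
  dn-coupled {G} u = coupled-↓ G (up-support u) (up-below u) λ i e →
    subst (_≤ m i) (sym (carry↓-step G (up-support u) (suc i))) (bound i e)
    where
    bound : ∀ i → E i ≡ false →
      prevCarry (E (suc i)) (M (suc i)) (carry↓ G (suc (suc i))) (G (suc i)) ≤ m i
    bound i e with E (suc i) in e′
    ... | true  = up-pass u i e e′ (Q-carry↓ u (suc (suc i)))
    ... | false = up-turn u i e e′

  rows↑-up : ∀ {k D} → Q k → Dn D → Up (rows↑ k D)
  rows↑-up q d = up-ok d (Q-carry↑ q d) (up-coupled d)

  rows↓-dn : ∀ {G} → Up G → Dn (rows↓ G)
  rows↓-dn u = dn-ok u (Q-carry↓ u) (dn-coupled u)

  dn-support : ∀ {D} → Dn D → ∀ {i} → N ≤ i → D i ≡ 0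
  dn-support {D} d {i} l = go (E i) (dn-below d i)
    where
    go : ∀ e → Below e (D i) (m i) → D i ≡ 0
    go true  p = trans p (m≡0 l)
    go false p = n≤0⇒n≡0 (subst (D i ≤_) (m≡0 l) p)

  raised : ∀ k (δ : Partition) → .(Q k) → .(Dn (row δ)) → Partition
  raised k δ q d = fromRows N (rows↑ k (row δ)) (up-decr (rows↑-up q d))
                     (up-support (rows↑-up q d) ≤-refl)

  lowered : ∀ (γ : Partition) → .(Up (row γ)) → Partition
  lowered γ u = fromRows N (rows↓ (row γ)) (dn-decr (rows↓-dn u)) (dn-support (rows↓-dn u) ≤-refl)

  row-raised : ∀ k δ .(q : Q k) .(d : Dn (row δ)) i → row (raised k δ q d) i ≡ rows↑ k (row δ) i
  row-raised k δ q d = row-fromRows N _ (up-decr (rows↑-up q d)) (up-support (rows↑-up q d) ≤-refl)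

  row-lowered : ∀ γ .(u : Up (row γ)) i → row (lowered γ u) i ≡ rows↓ (row γ) i
  row-lowered γ u = row-fromRows N _ (dn-decr (rows↓-dn u)) (dn-support (rows↓-dn u) ≤-refl)

  raised-up : ∀ k δ (q : Q k) (d : Dn (row δ)) → Up (row (raised k δ q d))
  raised-up k δ q d = up-resp (λ i → sym (row-raised k δ q d i)) (rows↑-up q d)

  lowered-dn : ∀ γ (u : Up (row γ)) → Dn (row (lowered γ u))
  lowered-dn γ u = dn-resp (λ i → sym (row-lowered γ u i)) (rows↓-dn u)

  coupled-resp : ∀ {c D D′ G G′} → (∀ i → D i ≡ D′ i) → (∀ i → G i ≡ G′ i) →
    Coupled c D G → Coupled c D′ G′
  coupled-resp {c} h h′ k i =
    subst₂ (Step (E i) (M i) (m i) (c i) (c (suc i))) (h i) (h′ i) (k i)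

  -- Lowering and raising each solve the same row equations. After lowering and raising, the two
  -- solutions share δ and the top carry; after raising and lowering, they share γ; in both cases
  -- they agree in every row.
  localRule : ∀ {n} → (∀ {N′} → N ≤ N′ → Σ< N′ (λ i → M i + m i) ≡ n) →
    LocalRule Q (Up ∘ row) (Dn ∘ row) n
  localRule {n} total = record
    { to = λ (γ , [ u ]) →
        (carry↓ (row γ) 0 , [ Q-carry↓ u 0 ])
      , (lowered γ u , [ lowered-dn γ u ])
    ; from = λ ((k , [ q ]) , (δ , [ d ])) →
        raised k δ q d , [ raised-up k δ q d ]
    ; to-from = λ ((k , [ q ]) , (δ , [ d ])) → to-from k δ q d
    ; from-to = λ (γ , [ u ]) → from-to γ u
    ; sizes = λ (γ , [ u ]) → sizes γ (up-recompute u)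
    }
    where
    from-to : ∀ γ .(u : Up (row γ)) → _
    from-to γ u =
      let δ = lowered γ u
          d! = dn-recompute {row δ} (lowered-dn γ u)
          eqs = coupled-↑-unique
                  (coupled-resp (λ i → sym (row-lowered γ u i)) (λ _ → refl)
                    (dn-coupled (up-recompute {row γ} u)))
                  (up-coupled {carry↓ (row γ) 0} {row δ} d!) refl
      in refinement-≡ (row-ext _ _ λ i →
           trans (row-raised (carry↓ (row γ) 0) δ (Q-carry↓ u 0) (lowered-dn γ u) i)
                 (sym (proj₂ (eqs i))))

    to-from : ∀ k δ .(q : Q k) .(d : Dn (row δ)) → _
    to-from k δ q d =
      let d! = dn-recompute d
          γ  = raised k δ q d
          u! = up-recompute {row γ} (raised-up k δ q d)
          eqs = coupled-↓-unique (dn-coupled u!)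
                  (coupled-resp (λ _ → refl) (λ i → sym (row-raised k δ q d i)) (up-coupled {k} d!))
      in cong₂ _,_ (refinement-≡ (proj₁ (eqs 0)))
           (refinement-≡ (row-ext _ _ λ i → trans (row-lowered γ (raised-up k δ q d) i) (proj₂ (eqs i))))

    sizes : ∀ γ (u : Up (row γ)) → size γ + size (lowered γ u) ≡ n + carry↓ (row γ) 0
    sizes γ u = begin
      size γ + size (lowered γ u)
        ≡⟨ cong₂ _+_ (size-Σ γ (≤-trans (m≤n+m _ N) (m≤m+n _ _)))
             (size-Σ (lowered γ u) {N′} (m≤n+m _ (N + len γ))) ⟩
      Σ< N′ (row γ) + Σ< N′ (row (lowered γ u))
        ≡⟨ cong (Σ< N′ (row γ) +_) (Σ<-cong N′ (row-lowered γ u)) ⟩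
      Σ< N′ (row γ) + Σ< N′ (rows↓ (row γ))
        ≡⟨ +-identityʳ _ ⟨
      Σ< N′ (row γ) + Σ< N′ (rows↓ (row γ)) + 0
        ≡⟨ cong (Σ< N′ (row γ) + Σ< N′ (rows↓ (row γ)) +_) (carry↓-≥ (row γ) N≤N′) ⟨
      Σ< N′ (row γ) + Σ< N′ (rows↓ (row γ)) + carry↓ (row γ) N′
        ≡⟨ coupled-sum (dn-coupled u) N′ ⟩
      Σ< N′ (λ i → M i + m i) + carry↓ (row γ) 0
        ≡⟨ cong (_+ _) (total N≤N′) ⟩
      n + carry↓ (row γ) 0 ∎
      where
      open ≡-Reasoning
      -- Large enough to contain both partitions and to lie beyond the last nonzero carry.
      N′ = N + len γ + len (lowered γ u)
      N≤N′ : N ≤ N′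
      N≤N′ = ≤-trans (m≤m+n N _) (m≤m+n _ _)

-- Horizontal and vertical strips and their local rules

HStrip VStrip : (g a : ℕ → ℕ) → Set
HStrip g a = ∀ i → a i ≤ g i × g (suc i) ≤ a i
VStrip g a = ∀ i → a i ≤ g i × g i ≤ suc (a i)

-- The Boolean is that of an entry: non-overlined entries of a given value fill a horizontal
-- strip, overlined ones a vertical strip.
Strip : Bool → (g a : ℕ → ℕ) → Set
Strip false = HStrip
Strip true  = VStrip

strip-recompute : ∀ κ {g a} → .(Strip κ g a) → Strip κ g a
strip-recompute false s i = recompute (_ ≤? _) (proj₁ (s i)) , recompute (_ ≤? _) (proj₂ (s i))
strip-recompute true  s i = recompute (_ ≤? _) (proj₁ (s i)) , recompute (_ ≤? _) (proj₂ (s i))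

strip-resp : ∀ κ {g g′ a a′} → (∀ i → g i ≡ g′ i) → (∀ i → a i ≡ a′ i) →
  Strip κ g a → Strip κ g′ a′
strip-resp false p q s i =
  subst₂ _≤_ (q i) (p i) (proj₁ (s i)) , subst₂ _≤_ (p (suc i)) (q i) (proj₂ (s i))
strip-resp true  p q s i =
  subst₂ _≤_ (q i) (p i) (proj₁ (s i)) , subst₂ _≤_ (p i) (cong suc (q i)) (proj₂ (s i))

⊔+⊓ : ∀ x y → (x ⊔ y) + (x ⊓ y) ≡ x + y
⊔+⊓ x y with ≤-total x y
... | inj₁ x≤y rewrite m≤n⇒m⊔n≡n x≤y | m≤n⇒m⊓n≡m x≤y = +-comm y x
... | inj₂ y≤x rewrite m≥n⇒m⊔n≡m y≤x | m≥n⇒m⊓n≡n y≤x = refl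

Σ<-+ : ∀ N (f g : ℕ → ℕ) → Σ< N (λ i → f i + g i) ≡ Σ< N f + Σ< N g
Σ<-+ zero    f g = refl
Σ<-+ (suc N) f g rewrite Σ<-+ N (f ∘ suc) (g ∘ suc) =
  solve 4 (λ x y s t → (x :+ y) :+ (s :+ t) := (x :+ s) :+ (y :+ t)) refl
    (f 0) (g 0) (Σ< N (f ∘ suc)) (Σ< N (g ∘ suc))
  where open +-*-Solver

module Pair (α β : Partition) where
  a b M m : ℕ → ℕ
  a = row α
  b = row β
  M i = a i ⊔ b i
  m i = a i ⊓ b i

  N₀ N : ℕ
  N₀ = len α + len β
  -- A horizontal strip on top of α may open one row below the last row of α.
  N  = suc N₀

  a≡0 : ∀ {i} → N₀ ≤ i → a i ≡ 0
  a≡0 l = row-≥len α (≤-trans (m≤m+n _ _) l)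
  b≡0 : ∀ {i} → N₀ ≤ i → b i ≡ 0
  b≡0 l = row-≥len β (≤-trans (m≤n+m _ _) l)
  M≡0 : ∀ {i} → N ≤ i → M i ≡ 0
  M≡0 l = cong₂ _⊔_ (a≡0 (<⇒≤ l)) (b≡0 (<⇒≤ l))
  m≡0 : ∀ {i} → N ≤ i → m i ≡ 0
  m≡0 l = cong₂ _⊓_ (a≡0 (<⇒≤ l)) (b≡0 (<⇒≤ l))

  total : ∀ {N′} → N ≤ N′ → Σ< N′ (λ i → M i + m i) ≡ size α + size β
  total {N′} l = trans (Σ<-cong N′ (λ i → ⊔+⊓ (a i) (b i))) (trans (Σ<-+ N′ a b)
    (sym (cong₂ _+_ (size-Σ α (≤-trans (m≤m+n _ _) (<⇒≤ l))) (size-Σ β (≤-trans (m≤n+m _ _) (<⇒≤ l))))))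

-- Arbitrary multiplicities account for 1/(1 - x y), multiplicities at most 1 for 1 + x y. In a
-- mixed pair the cap comes from the vertical strip γ/β: a turning row has γ_i = β_i + c_i, which
-- may not exceed β_i + 1.
Allowed : (κ κ′ : Bool) → ℕ → Set
Allowed false false c = ⊤
Allowed true  true  c = ⊤
Allowed false true  c = c ≤ 1
Allowed true  false c = c ≤ 1

-- A square of partitions whose opposite sides are of the same kind: γ/β and α/δ are κ-strips, γ/α
-- and β/δ are κ′-strips. Replacing the upper sides by the lower ones moves one strip past the
-- other.
StripUp StripDn : (κ κ′ : Bool) (α β : Partition) → (ℕ → ℕ) → Set
StripUp κ κ′ α β g = Strip κ g (row β) × Strip κ′ g (row α)
StripDn κ κ′ α β d = Strip κ (row α) d × Strip κ′ (row β) d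

StripRule : (κ κ′ : Bool) (α β : Partition) → Set
StripRule κ κ′ α β =
  LocalRule (Allowed κ κ′) (StripUp κ κ′ α β ∘ row) (StripDn κ κ′ α β ∘ row) (size α + size β)

module _ (α β : Partition) where
  open Pair α β

  -- Rows `i` and `i + 1` share the carry `c (i + 1)`, which is added to `M (i + 1)` to give
  -- `g (i + 1)` and to `d i` to give `m i`. Hence `g (i + 1) ≤ m i` and `M (i + 1) ≤ d i` are
  -- equivalent, and these are the strip conditions above and below.
  horizontalCarryRule : CarryRule (λ _ → false) M m N (λ _ → ⊤)
    (StripUp false false α β) (StripDn false false α β)
  horizontalCarryRule = record
    { E≡false      = λ _ → refl
    ; M≡0          = M≡0
    ; m≡0          = m≡0
    ; Q-zero       = tt
    ; up-recompute = λ u → strip-recompute false (proj₁ u) , strip-recompute false (proj₂ u)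
    ; up-resp      = λ h (s , t) → strip-resp false h (λ _ → refl) s , strip-resp false h (λ _ → refl) t
    ; up-decr      = λ (s , t) i → ≤-trans (proj₂ (s i)) (proj₁ (s i))
    ; up-support   = λ { (s , t) {suc i} (s≤s l) → n≤0⇒n≡0 (≤-trans (proj₂ (t i)) (≤-reflexive (a≡0 l))) }
    ; up-below     = λ (s , t) i → ⊔-lub (proj₁ (t i)) (proj₁ (s i))
    ; up-carry     = λ _ _ _ → tt
    ; up-turn      = λ {G} (s , t) i _ _ →
        ≤-trans (m∸n≤m (G (suc i)) (M (suc i))) (⊓-glb (proj₂ (t i)) (proj₂ (s i)))
    ; up-pass      = λ { _ _ _ () }
    ; up-ok        = λ d _ k → (λ i → proj₂ (above d k i)) , (λ i → proj₁ (above d k i))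
    ; dn-recompute = λ d → strip-recompute false (proj₁ d) , strip-recompute false (proj₂ d)
    ; dn-resp      = λ h (s , t) → strip-resp false (λ _ → refl) h s , strip-resp false (λ _ → refl) h t
    ; dn-decr      = λ (s , t) i → ≤-trans (proj₁ (s (suc i))) (proj₂ (s i))
    ; dn-below     = λ (s , t) i → ⊓-glb (proj₁ (s i)) (proj₁ (t i))
    ; dn-carry     = λ _ _ _ → tt
    ; dn-ok        = λ u _ k → (λ i → proj₁ (below u k i)) , (λ i → proj₂ (below u k i))
    }
    where
    open Carries (λ _ → false) M m

    above : ∀ {c D G} → StripDn false false α β D → Coupled c D G →
      ∀ i → (a i ≤ G i × G (suc i) ≤ a i) × (b i ≤ G i × G (suc i) ≤ b i)
    above {c} {D} {G} (s , t) k i with k i | k (suc i)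
    ... | turn p q | turn _ q′ =
      (≤-trans (m≤m⊔n (a i) (b i)) M≤G , ≤-trans G≤m (m⊓n≤m (a i) (b i))) ,
      (≤-trans (m≤n⊔m (a i) (b i)) M≤G , ≤-trans G≤m (m⊓n≤n (a i) (b i)))
      where
      M≤G : M i ≤ G i
      M≤G = ≤-trans (m≤m+n _ _) (≤-reflexive (sym q))
      G≤m : G (suc i) ≤ m i
      G≤m = ≤-trans (≤-reflexive q′) (≤-trans
        (+-monoˡ-≤ (c (suc i)) (⊔-lub (proj₂ (s i)) (proj₂ (t i)))) (≤-reflexive p))

    below : ∀ {c D G} → StripUp false false α β G → Coupled c D G →
      ∀ i → (D i ≤ a i × a (suc i) ≤ D i) × (D i ≤ b i × b (suc i) ≤ D i)
    below {c} {D} {G} (s , t) k i with k i | k (suc i)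
    ... | turn p q | turn _ q′ =
      (≤-trans D≤m (m⊓n≤m (a i) (b i)) , ≤-trans (m≤m⊔n (a (suc i)) (b (suc i))) M≤D) ,
      (≤-trans D≤m (m⊓n≤n (a i) (b i)) , ≤-trans (m≤n⊔m (a (suc i)) (b (suc i))) M≤D)
      where
      D≤m : D i ≤ m i
      D≤m = ≤-trans (m≤m+n _ _) (≤-reflexive p)
      M≤D : M (suc i) ≤ D i
      M≤D = +-cancelʳ-≤ (c (suc i)) _ _ (≤-trans (≤-reflexive (sym q′))
        (≤-trans (⊓-glb (proj₂ (t i)) (proj₂ (s i))) (≤-reflexive (sym p))))

  horizontalRule : StripRule false false α β
  horizontalRule = CarryRule.localRule horizontalCarryRule total

  -- In a mixed square `a i ≤ b i + 1`. In case of equality (`tight`) the bounds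
  -- `a i ≤ g i ≤ b i + 1` and `a i ≤ d i + 1`, `d i ≤ b i` fix both `g i` and `d i`; otherwise
  -- (`loose`) the maximum is `b i` and the minimum is `a i`.
  data Cell : Bool → (x y M m : ℕ) → Set where
    tight : ∀ {y} → Cell true (suc y) y (suc y) y
    loose : ∀ {x y} → x ≤ y → Cell false x y y x

  E : ℕ → Bool
  E i = b i <ᵇ a i

  cell : ∀ i → a i ≤ suc (b i) → Cell (E i) (a i) (b i) (M i) (m i)
  cell i = go (a i) (b i)
    where
    go : ∀ x y → x ≤ suc y → Cell (y <ᵇ x) x y (x ⊔ y) (x ⊓ y)
    go x y l with y <ᵇ x in e
    ... | true rewrite ≤-antisym l (<ᵇ⇒< y x (subst T (sym e) tt))
                     | m≥n⇒m⊔n≡m (n≤1+n y) | m≥n⇒m⊓n≡n (n≤1+n y) = tight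
    ... | false = subst₂ (Cell false x y) (sym (m≤n⇒m⊔n≡n x≤y)) (sym (m≤n⇒m⊓n≡m x≤y)) (loose x≤y)
      where
      x≤y : x ≤ y
      x≤y = ≮⇒≥ λ y<x → subst T e (<⇒<ᵇ y<x)

  mixedCarryRule : CarryRule E M m N (_≤ 1) (StripUp true false α β) (StripDn true false α β)
  mixedCarryRule = record
    { E≡false      = λ {i} l → subst (λ x → (b i <ᵇ x) ≡ false) (sym (a≡0 (<⇒≤ l))) refl
    ; M≡0          = M≡0
    ; m≡0          = m≡0
    ; Q-zero       = z≤n
    ; up-recompute = λ u → strip-recompute true (proj₁ u) , strip-recompute false (proj₂ u)
    ; up-resp      = λ h (s , t) → strip-resp true h (λ _ → refl) s , strip-resp false h (λ _ → refl) t
    ; up-decr      = λ (s , t) i → ≤-trans (proj₂ (t i)) (proj₁ (t i))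
    ; up-support   = λ { (s , t) {suc i} (s≤s l) → n≤0⇒n≡0 (≤-trans (proj₂ (t i)) (≤-reflexive (a≡0 l))) }
    ; up-below     = λ (s , t) i →
        up-below (cell i (a≤1+b↑ (s , t) i)) (proj₁ (s i)) (proj₂ (s i)) (proj₁ (t i))
    ; up-carry     = λ (s , t) i _ → m≤n+o⇒m∸n≤o _ _ (≤-trans (proj₂ (s i))
        (≤-trans (s≤s (m≤n⊔m (a i) (b i))) (≤-reflexive (+-comm 1 (M i)))))
    ; up-turn      = λ {G} (s , t) i e _ → ≤-trans (m∸n≤m (G (suc i)) (M (suc i)))
        (≤-trans (proj₂ (t i)) (≤-reflexive (sym (m≡a (cell i (a≤1+b↑ (s , t) i)) e))))
    -- Row `i + 1` is tight, so `a (i + 1)` is positive; then so is `a i`, which is the minimum in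
    -- row `i`, and a carry of at most 1 fits.
    ; up-pass      = λ {G} (s , t) i e e′ c≤1 → ≤-trans c≤1 (≤-trans
        (≤-trans (s≤s z≤n) (<ᵇ⇒< (b (suc i)) (a (suc i)) (subst T (sym e′) tt)))
        (≤-trans (row-decr α i) (≤-reflexive (sym (m≡a (cell i (a≤1+b↑ (s , t) i)) e)))))
    ; up-ok        = λ {c} {D} {G} d q k →
        (λ i → above-V (cell i (a≤1+b↓ d i)) (q i) (k i)) ,
        (λ i → above-H₁ (cell i (a≤1+b↓ d i)) (k i)
             , above-H₂ (cell i (a≤1+b↓ d i)) (cell (suc i) (a≤1+b↓ d (suc i)))
                 (k i) (k (suc i)) (q (suc i)) (row-decr α i) (row-decr β i) (proj₂ (proj₂ d i)))
    ; dn-recompute = λ d → strip-recompute true (proj₁ d) , strip-recompute false (proj₂ d)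
    ; dn-resp      = λ h (s , t) → strip-resp true (λ _ → refl) h s , strip-resp false (λ _ → refl) h t
    ; dn-decr      = λ (s , t) i → ≤-trans (proj₁ (t (suc i))) (proj₂ (t i))
    ; dn-below     = λ (s , t) i →
        dn-below (cell i (a≤1+b↓ (s , t) i)) (proj₁ (s i)) (proj₂ (s i)) (proj₁ (t i))
    ; dn-carry     = λ {D} (s , t) i _ → m≤n+o⇒m∸n≤o _ _ (≤-trans (m⊓n≤m (a i) (b i))
        (≤-trans (proj₂ (s i)) (≤-reflexive (+-comm 1 (D i)))))
    ; dn-ok        = λ {c} {D} {G} u q k →
        (λ i → below-V (cell i (a≤1+b↑ u i)) (q (suc i)) (k i)) ,
        (λ i → below-H₁ (cell i (a≤1+b↑ u i)) (k i)
             , below-H₂ (cell i (a≤1+b↑ u i)) (cell (suc i) (a≤1+b↑ u (suc i)))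
                 (k i) (k (suc i)) (q (suc i)) (row-decr α i) (row-decr β i) (proj₂ (proj₂ u i)))
    }
    where
    a≤1+b↑ : ∀ {G} → StripUp true false α β G → ∀ i → a i ≤ suc (b i)
    a≤1+b↑ (s , t) i = ≤-trans (proj₁ (t i)) (proj₂ (s i))

    a≤1+b↓ : ∀ {D} → StripDn true false α β D → ∀ i → a i ≤ suc (b i)
    a≤1+b↓ (s , t) i = ≤-trans (proj₂ (s i)) (s≤s (proj₁ (t i)))

    m≡a : ∀ {e x y M m} → Cell e x y M m → e ≡ false → m ≡ x
    m≡a (loose _) refl = refl

    up-below : ∀ {e x y M m g} → Cell e x y M m → y ≤ g → g ≤ suc y → x ≤ g → Below e M g
    up-below tight     _ p q = ≤-antisym q p
    up-below (loose _) p _ _ = p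

    dn-below : ∀ {e x y M m d} → Cell e x y M m → d ≤ x → x ≤ suc d → d ≤ y → Below e d m
    dn-below tight     _ p q = ≤-antisym q (≤-pred p)
    dn-below (loose _) p _ _ = p

    above-V : ∀ {e x y M m c c′ d g} → Cell e x y M m → c ≤ 1 → Step e M m c c′ d g →
      y ≤ g × g ≤ suc y
    above-V tight _ (pass _ refl _) = n≤1+n _ , ≤-refl
    above-V {y = y} (loose _) l (turn _ refl) =
      m≤m+n _ _ , ≤-trans (+-monoʳ-≤ y l) (≤-reflexive (+-comm y 1))

    above-H₁ : ∀ {e x y M m c c′ d g} → Cell e x y M m → Step e M m c c′ d g → x ≤ g
    above-H₁ tight     (pass _ refl _) = ≤-refl
    above-H₁ (loose l) (turn _ refl)   = ≤-trans l (m≤m+n _ _)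

    -- The condition that links two rows. If the lower row is tight, then `g′ = x′` and the decrease
    -- of α is enough; if only the upper row is tight, the unit in `x = y + 1` pays for a carry of
    -- at most 1; two loose rows share their carry as in the horizontal rule.
    above-H₂ : ∀ {e x y M m c c′ d g e′ x′ y′ M′ m′ c″ d′ g′} →
      Cell e x y M m → Cell e′ x′ y′ M′ m′ →
      Step e M m c c′ d g → Step e′ M′ m′ c′ c″ d′ g′ →
      c′ ≤ 1 → x′ ≤ x → y′ ≤ y → y′ ≤ d → g′ ≤ x
    above-H₂ _ tight _ (pass _ refl _) _ p _ _ = p
    above-H₂ {y = y} tight (loose _) _ (turn _ refl) l _ p _ =
      ≤-trans (+-mono-≤ p l) (≤-reflexive (+-comm y 1))
    above-H₂ (loose _) (loose _) (turn refl _) (turn _ refl) _ _ _ p = +-monoˡ-≤ _ p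

    below-V : ∀ {e x y M m c c′ d g} → Cell e x y M m → c′ ≤ 1 → Step e M m c c′ d g →
      d ≤ x × x ≤ suc d
    below-V tight _ (pass refl _ _) = n≤1+n _ , ≤-refl
    below-V {d = d} (loose _) l (turn refl _) =
      m≤m+n _ _ , ≤-trans (+-monoʳ-≤ d l) (≤-reflexive (+-comm d 1))

    below-H₁ : ∀ {e x y M m c c′ d g} → Cell e x y M m → Step e M m c c′ d g → d ≤ y
    below-H₁ tight     (pass refl _ _) = ≤-refl
    below-H₁ (loose l) (turn refl _)   = ≤-trans (m≤m+n _ _) l

    below-H₂ : ∀ {e x y M m c c′ d g e′ x′ y′ M′ m′ c″ d′ g′} →
      Cell e x y M m → Cell e′ x′ y′ M′ m′ →
      Step e M m c c′ d g → Step e′ M′ m′ c′ c″ d′ g′ →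
      c′ ≤ 1 → x′ ≤ x → y′ ≤ y → g′ ≤ x → y′ ≤ d
    below-H₂ tight _ (pass refl _ _) _ _ _ p _ = p
    -- Here `x′ = y′ + 1`, and this unit absorbs the carry.
    below-H₂ {d = d} (loose _) tight (turn refl _) _ l p _ _ =
      ≤-pred (≤-trans p (≤-trans (+-monoʳ-≤ d l) (≤-reflexive (+-comm d 1))))
    below-H₂ (loose _) (loose _) (turn refl _) (turn _ refl) _ _ _ p = +-cancelʳ-≤ _ _ _ p

  mixedRule : StripRule true false α β
  mixedRule = CarryRule.localRule mixedCarryRule total

-- The square is reflected in its diagonal from γ to δ, which exchanges α with β and the two kinds
-- of strips.
swapRule : ∀ α β → StripRule true false β α → StripRule false true α β
swapRule α β r = record
  { to      = λ (γ , [ u ]) → let (c , (δ , [ d ])) = to (γ , [ swap u ]) in c , (δ , [ swap d ])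
  ; from    = λ (c , (δ , [ d ])) → let (γ , [ u ]) = from (c , (δ , [ swap d ])) in γ , [ swap u ]
  ; to-from = λ (c , (δ , [ d ])) →
      cong (λ (c , (δ , [ d ])) → c , (δ , [ swap d ])) (to-from (c , (δ , [ swap d ])))
  ; from-to = λ (γ , [ u ]) → cong (λ (γ , [ u ]) → γ , [ swap u ]) (from-to (γ , [ swap u ]))
  ; sizes   = λ (γ , [ u ]) → trans (sizes (γ , [ swap u ]))
      (cong (_+ value (proj₁ (to (γ , [ swap u ])))) (+-comm (size β) (size α)))
  }
  where open LocalRule r

-- Conjugation

≤-from-< : ∀ {x y} → (∀ j → j < x → j < y) → x ≤ y
≤-from-< {zero}  h = z≤n
≤-from-< {suc x} h = h x ≤-refl

indicator : ℕ → ℕ → ℕ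
indicator x j = if j <ᵇ x then 1 else 0

Σ<-indicator : ∀ M x → x ≤ M → Σ< M (indicator x) ≡ x
Σ<-indicator zero    zero    _       = refl
Σ<-indicator (suc M) zero    _       = Σ<-indicator M zero z≤n
Σ<-indicator (suc M) (suc x) (s≤s l) = cong suc (Σ<-indicator M x l)

columnHeight : ℕ → (ℕ → ℕ) → ℕ → ℕ
columnHeight zero    f j = 0
columnHeight (suc N) f j = indicator (f 0) j + columnHeight N (f ∘ suc) j

-- Double counting of the cells; the bound on `f` guarantees that `M` columns exhaust the diagram.
Σ<-columnHeight : ∀ M N f → (∀ i → f i ≤ M) → Σ< M (columnHeight N f) ≡ Σ< N f
Σ<-columnHeight M zero    f h = zeros M
  where
  zeros : ∀ M → Σ< M (λ _ → 0) ≡ 0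
  zeros zero    = refl
  zeros (suc M) = zeros M
Σ<-columnHeight M (suc N) f h = trans (Σ<-+ M (indicator (f 0)) (columnHeight N (f ∘ suc)))
  (cong₂ _+_ (Σ<-indicator M (f 0) (h 0)) (Σ<-columnHeight M N (f ∘ suc) (h ∘ suc)))

decr-≤0 : ∀ {f} → Decreasing f → ∀ i → f i ≤ f 0
decr-≤0 d zero    = ≤-refl
decr-≤0 d (suc i) = ≤-trans (d i) (decr-≤0 d i)

columnHeight-≥ : ∀ N {f} → Decreasing f → ∀ {j} → f 0 ≤ j → columnHeight N f j ≡ 0
columnHeight-≥ zero    d l = refl
columnHeight-≥ (suc N) {f} d {j} l with j <ᵇ f 0 in e
... | true  = contradiction (<ᵇ⇒< j (f 0) (subst T (sym e) tt)) (≤⇒≯ l)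
... | false = columnHeight-≥ N (d ∘ suc) (≤-trans (d 0) l)

columnHeight-decr : ∀ N f → Decreasing (columnHeight N f)
columnHeight-decr zero    f j = z≤n
columnHeight-decr (suc N) f j = +-mono-≤ (indicator-decr (f 0) j) (columnHeight-decr N (f ∘ suc) j)
  where
  indicator-decr : ∀ x j → indicator x (suc j) ≤ indicator x j
  indicator-decr zero          j       = z≤n
  indicator-decr (suc zero)    j       = z≤n
  indicator-decr (suc (suc x)) zero    = ≤-refl
  indicator-decr (suc (suc x)) (suc j) = indicator-decr (suc x) j

<-columnHeight : ∀ N {f} → Decreasing f → ∀ {i j} → i < columnHeight N f j → j < f i
<-columnHeight (suc N) {f} d {i} {j} l with j <ᵇ f 0 in e
<-columnHeight (suc N) {f} d {zero}  {j} l       | true  = <ᵇ⇒< j (f 0) (subst T (sym e) tt)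
<-columnHeight (suc N) {f} d {suc i} {j} (s≤s l) | true  = <-columnHeight N (d ∘ suc) l
<-columnHeight (suc N) {f} d {i}     {j} l       | false =
  contradiction (≤-trans (s≤s z≤n) l)
    (≤⇒≯ (≤-reflexive (columnHeight-≥ N (d ∘ suc) (≤-trans (d 0) (≮⇒≥ λ p → subst T e (<⇒<ᵇ p))))))

columnHeight-> : ∀ N {f} → Decreasing f → ∀ {i j} → i < N → j < f i → i < columnHeight N f j
columnHeight-> (suc N) {f} d {i} {j} i<N l with j <ᵇ f 0 in e
columnHeight-> (suc N) d {zero}  i<N       l | true  = s≤s z≤n
columnHeight-> (suc N) d {suc i} (s≤s i<N) l | true  = s≤s (columnHeight-> N (d ∘ suc) i<N l)
columnHeight-> (suc N) d {i}     i<N       l | false =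
  contradiction (≤-trans l (decr-≤0 d i)) λ p → subst T e (<⇒<ᵇ p)

conj : Partition → Partition
conj p = fromRows (row p 0) (columnHeight (len p) (row p)) (columnHeight-decr (len p) (row p))
           (columnHeight-≥ (len p) (row-decr p) ≤-refl)

row-conj : ∀ p j → row (conj p) j ≡ columnHeight (len p) (row p) j
row-conj p = row-fromRows (row p 0) _ (columnHeight-decr (len p) (row p))
           (columnHeight-≥ (len p) (row-decr p) ≤-refl)

-- Together with `conj-cell⇐` this says that the diagram is transposed. Involutivity and the
-- exchange of the two kinds of strips are read off cell by cell from these two facts.
conj-cell⇒ : ∀ p {i j} → i < row (conj p) j → j < row p i
conj-cell⇒ p {i} {j} l = <-columnHeight (len p) (row-decr p) (subst (i <_) (row-conj p j) l)

conj-cell⇐ : ∀ p {i j} → j < row p i → i < row (conj p) j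
conj-cell⇐ p {i} {j} l = subst (i <_) (sym (row-conj p j))
  (columnHeight-> (len p) (row-decr p) (≰⇒> λ le → n≮0 (subst (j <_) (row-≥len p le) l)) l)

conj-involutive : ∀ p → conj (conj p) ≡ p
conj-involutive p = row-ext _ _ λ i → ≤-antisym
  (≤-from-< λ j l → conj-cell⇒ p (conj-cell⇒ (conj p) l))
  (≤-from-< λ j l → conj-cell⇐ (conj p) (conj-cell⇐ p l))

size-conj : ∀ p → size (conj p) ≡ size p
size-conj p = begin
  size (conj p)                                     ≡⟨ size-Σ (conj p) (length-build (row p 0) _) ⟩
  Σ< (row p 0) (row (conj p))                       ≡⟨ Σ<-cong (row p 0) (row-conj p) ⟩
  Σ< (row p 0) (columnHeight (len p) (row p))       ≡⟨ Σ<-columnHeight (row p 0) (len p) (row p) (decr-≤0 (row-decr p)) ⟩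
  Σ< (len p) (row p)                                ≡⟨ size-Σ p ≤-refl ⟨
  size p                                            ∎
  where
  open ≡-Reasoning
  open FiniteSupport 0 (_≟ 0)

conj-strip : ∀ κ γ α → Strip κ (row γ) (row α) → Strip (not κ) (row (conj γ)) (row (conj α))
conj-strip false γ α s j =
  (≤-from-< λ i l → conj-cell⇐ γ (≤-trans (conj-cell⇒ α l) (proj₁ (s i)))) ,
  (≤-from-< λ where
    -- A horizontal strip bounds row `i + 1` of γ by row `i` of α, so the top cell of a column of γ
    -- has no partner; it accounts for the unit allowed in a vertical strip.
    zero    l → s≤s z≤n
    (suc i) l → s≤s (conj-cell⇐ α (≤-trans (conj-cell⇒ γ l) (proj₂ (s i)))))
conj-strip true γ α s j =
  (≤-from-< λ i l → conj-cell⇐ γ (≤-trans (conj-cell⇒ α l) (proj₁ (s i)))) ,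
  (≤-from-< λ i l → conj-cell⇐ α (≤-pred (≤-trans (conj-cell⇒ γ l) (proj₂ (s i)))))

conj-strip⁻ : ∀ κ γ α → Strip κ (row (conj γ)) (row (conj α)) → Strip (not κ) (row γ) (row α)
conj-strip⁻ κ γ α s =
  subst₂ (λ γ α → Strip (not κ) (row γ) (row α)) (conj-involutive γ) (conj-involutive α)
    (conj-strip κ (conj γ) (conj α) s)

conj-strip⁻ˡ : ∀ κ γ α → Strip κ (row γ) (row (conj α)) → Strip (not κ) (row (conj γ)) (row α)
conj-strip⁻ˡ κ γ α s = conj-strip⁻ κ (conj γ) α
  (subst (λ γ → Strip κ (row γ) (row (conj α))) (sym (conj-involutive γ)) s)

conj-strip⁻ʳ : ∀ κ γ α → Strip κ (row (conj γ)) (row α) → Strip (not κ) (row γ) (row (conj α))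
conj-strip⁻ʳ κ γ α s = conj-strip⁻ κ γ (conj α)
  (subst (λ α → Strip κ (row (conj γ)) (row α)) (sym (conj-involutive α)) s)

conjRule : ∀ α β → StripRule false false (conj α) (conj β) → StripRule true true α β
conjRule α β r = record
  { to      = λ (γ , [ u ]) → let (c , (δ , [ d ])) = to (conj↑ (γ , [ u ])) in
      (value c , [ tt ]) , (conj δ , [ unconj↓ δ d ])
  ; from    = λ ((c , _) , (δ , [ d ])) →
      let (γ , [ u ]) = from ((c , [ tt ]) , conj↓ (δ , [ d ])) in conj γ , [ unconj↑ γ u ]
  ; to-from = λ ((c , _) , (δ , [ d ])) →
      let y = ((c , [ tt ]) , conj↓ (δ , [ d ]))
          e = trans (cong to (refinement-≡ (conj-involutive (value (from y))))) (to-from y)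
      in cong₂ _,_ (cong (λ x → value (proj₁ x) , [ tt ]) e)
           (refinement-≡ (trans (cong (λ x → conj (value (proj₂ x))) e) (conj-involutive δ)))
  ; from-to = λ (γ , [ u ]) →
      let x = conj↑ (γ , [ u ])
          e = trans (cong (λ δ → from (proj₁ (to x) , δ))
                (refinement-≡ {x = conj↓ (conj (δ x) , [ unconj↓ (δ x) (recover (proj₂ (to x))) ])}
                   (conj-involutive (δ x)))) (from-to x)
      in refinement-≡ (trans (cong (conj ∘ value) e) (conj-involutive γ))
  ; sizes   = λ (γ , [ u ]) → let (c , (δ , [ d ])) = to (conj↑ (γ , [ u ])) in
      trans (cong₂ _+_ (sym (size-conj γ)) (size-conj δ)) (trans (sizes (conj↑ (γ , [ u ])))
        (cong (_+ value c) (cong₂ _+_ (size-conj α) (size-conj β))))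
  }
  where
  open LocalRule r

  δ : Refinement Partition (StripUp false false (conj α) (conj β) ∘ row) → Partition
  δ x = value (proj₂ (to x))

  conj↑ : Refinement Partition (StripUp true true α β ∘ row) →
          Refinement Partition (StripUp false false (conj α) (conj β) ∘ row)
  conj↑ (γ , [ u ]) = conj γ , [ (conj-strip true γ β (proj₁ u) , conj-strip true γ α (proj₂ u)) ]

  conj↓ : Refinement Partition (StripDn true true α β ∘ row) →
          Refinement Partition (StripDn false false (conj α) (conj β) ∘ row)
  conj↓ (δ , [ d ]) = conj δ , [ (conj-strip true α δ (proj₁ d) , conj-strip true β δ (proj₂ d)) ]

  unconj↑ : ∀ γ → StripUp false false (conj α) (conj β) (row γ) → StripUp true true α β (row (conj γ))
  unconj↑ γ (s , t) = conj-strip⁻ˡ false γ β s , conj-strip⁻ˡ false γ α t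

  unconj↓ : ∀ δ → StripDn false false (conj α) (conj β) (row δ) → StripDn true true α β (row (conj δ))
  unconj↓ δ (s , t) = conj-strip⁻ʳ′ α δ s , conj-strip⁻ʳ′ β δ t
    where
    conj-strip⁻ʳ′ : ∀ α δ → HStrip (row (conj α)) (row δ) → VStrip (row α) (row (conj δ))
    conj-strip⁻ʳ′ α δ = conj-strip⁻ʳ false α δ

  recover : (x : Refinement Partition (StripDn false false (conj α) (conj β) ∘ row)) →
    StripDn false false (conj α) (conj β) (row (value x))
  recover (δ , [ d ]) = strip-recompute false (proj₁ d) , strip-recompute false (proj₂ d)

stripRule : ∀ κ κ′ α β → StripRule κ κ′ α β
stripRule false false = horizontalRule
stripRule true  false = mixedRule
stripRule false true  = λ α β → swapRule α β (mixedRule β α)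
stripRule true  true  = λ α β → conjRule α β (horizontalRule (conj α) (conj β))

-- Chains of strips

Σ<-mono : ∀ N {f g : ℕ → ℕ} → (∀ i → f i ≤ g i) → Σ< N f ≤ Σ< N g
Σ<-mono zero    h = z≤n
Σ<-mono (suc N) h = +-mono-≤ (h 0) (Σ<-mono N (h ∘ suc))

strip-⊆ : ∀ κ {g a} → Strip κ g a → ∀ i → a i ≤ g i
strip-⊆ false s i = proj₁ (s i)
strip-⊆ true  s i = proj₁ (s i)

strip-size : ∀ κ γ α → .(Strip κ (row γ) (row α)) → size α ≤ size γ
strip-size κ γ α s = subst₂ _≤_ (sym (size-Σ α (m≤n+m _ (len γ)))) (sym (size-Σ γ (m≤m+n _ (len α))))
  (Σ<-mono (len γ + len α) (strip-⊆ κ (strip-recompute κ s)))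

letterWt : Entry → Weight
letterWt (v , o) = (if o then 1 else 0) , v

StripClass : Entry → Partition → Partition → Class
StripClass ℓ γ α = class (Irrelevant (Strip (over ℓ) (row γ) (row α)))
                         (λ _ → letterWt ℓ ·ʷ (size γ ∸ size α))

Multiples : (ℕ → Set) → Weight → Class
Multiples Q u = class (Refinement ℕ Q) (λ c → u ·ʷ value c)

Repeats : Entry → Class
Repeats ℓ = Multiples (Allowed (over ℓ) (over ℓ)) (letterWt ℓ)

Crossing : Entry → Entry → Class
Crossing ℓ ℓ′ = Multiples (Allowed (over ℓ) (over ℓ′)) (letterWt ℓ +ʷ letterWt ℓ′)

-- Passing from γ/β to α/δ a strip loses exactly c cells. By symmetry the other strip loses c cells
-- too, which is why the crossing has the weight of (x y)^c.
excess : ∀ g d a b c → d ≤ a → g + d ≡ (a + b) + c → g ∸ b ≡ c + (a ∸ d)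
excess g d a b c d≤a e = trans (cong (_∸ b) g≡) (m+n∸m≡n b _)
  where
  open +-*-Solver
  g≡ : g ≡ b + (c + (a ∸ d))
  g≡ = +-cancelʳ-≡ d _ _ (trans e (trans (cong (λ a → (a + b) + c) (sym (m∸n+n≡m d≤a)))
    (solve 4 (λ t d b c → ((t :+ d) :+ b) :+ c := (b :+ (c :+ t)) :+ d) refl (a ∸ d) d b c)))

exchange : ∀ ℓ ℓ′ α β → ⨆[ γ ∈ Partition ] (StripClass ℓ γ β ⊗ StripClass ℓ′ γ α)
  ≅ Crossing ℓ ℓ′ ⊗ (⨆[ δ ∈ Partition ] (StripClass ℓ α δ ⊗ StripClass ℓ′ β δ))
exchange ℓ ℓ′ α β = viaRule (stripRule (over ℓ) (over ℓ′) α β)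
  where
  viaRule : StripRule (over ℓ) (over ℓ′) α β → _ ≅ _
  viaRule r = record
    { to      = λ (γ , [ s ] , [ t ]) → let (c , (δ , [ d ])) = to (γ , [ (s , t) ]) in
                  c , δ , [ proj₁ d ] , [ proj₂ d ]
    ; from    = λ (c , δ , [ s ] , [ t ]) → let (γ , [ u ]) = from (c , (δ , [ (s , t) ])) in
                  γ , [ proj₁ u ] , [ proj₂ u ]
    ; to-from = λ (c , δ , [ s ] , [ t ]) →
        cong (λ (c , (δ , [ d ])) → c , δ , [ proj₁ d ] , [ proj₂ d ]) (to-from (c , (δ , [ (s , t) ])))
    ; from-to = λ (γ , [ s ] , [ t ]) →
        cong (λ (γ , [ u ]) → γ , [ proj₁ u ] , [ proj₂ u ]) (from-to (γ , [ (s , t) ]))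
    ; wt-to   = λ (γ , [ s ] , [ t ]) → weights γ [ (s , t) ]
    }
    where
    open LocalRule r
    u = letterWt ℓ
    v = letterWt ℓ′
    a = size α
    b = size β
    weights : ∀ γ s →
      let (c , (δ , _)) = to (γ , s)
      in (u +ʷ v) ·ʷ value c +ʷ (u ·ʷ (a ∸ size δ) +ʷ v ·ʷ (b ∸ size δ))
         ≡ u ·ʷ (size γ ∸ b) +ʷ v ·ʷ (size γ ∸ a)
    weights γ s with to (γ , s) | sizes (γ , s)
    ... | (c , _) , (δ , [ d ]) | e = begin
      (u +ʷ v) ·ʷ c +ʷ (x +ʷ y)
        ≡⟨ cong (_+ʷ (x +ʷ y)) (·ʷ-distribʳ c u v) ⟩
      (u ·ʷ c +ʷ v ·ʷ c) +ʷ (x +ʷ y)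
        ≡⟨ solve 4 (λ p q x y → (p ⊙ q) ⊙ (x ⊙ y) ⊜ (p ⊙ x) ⊙ (q ⊙ y)) refl (u ·ʷ c) (v ·ʷ c) x y ⟩
      (u ·ʷ c +ʷ x) +ʷ (v ·ʷ c +ʷ y)
        ≡⟨ cong₂ _+ʷ_ (·ʷ-distribˡ u c _) (·ʷ-distribˡ v c _) ⟨
      u ·ʷ (c + (a ∸ size δ)) +ʷ v ·ʷ (c + (b ∸ size δ))
        ≡⟨ cong₂ (λ s t → u ·ʷ s +ʷ v ·ʷ t)
             (excess (size γ) (size δ) a b c (strip-size (over ℓ) α δ (proj₁ d)) e)
             (excess (size γ) (size δ) b a c (strip-size (over ℓ′) β δ (proj₂ d))
               (trans e (cong (_+ c) (+-comm a b)))) ⟨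
      u ·ʷ (size γ ∸ b) +ʷ v ·ʷ (size γ ∸ a) ∎
      where
      open ≡-Reasoning
      open +ʷ-Solver renaming (_⊕_ to _⊙_)
      x = u ·ʷ (a ∸ size δ)
      y = v ·ʷ (b ∸ size δ)

-- The local rule with α = β = μ, where both strips of each pair coincide.
reflect : ∀ ℓ μ → ⨆[ γ ∈ Partition ] StripClass ℓ γ μ ≅ Repeats ℓ ⊗ (⨆[ δ ∈ Partition ] StripClass ℓ μ δ)
reflect ℓ μ = viaRule (stripRule (over ℓ) (over ℓ) μ μ)
  where
  viaRule : StripRule (over ℓ) (over ℓ) μ μ → _ ≅ _
  viaRule r = record
    { to      = λ (γ , [ s ]) → let (c , (δ , [ d ])) = to (γ , [ (s , s) ]) in c , δ , [ proj₁ d ]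
    ; from    = λ (c , δ , [ s ]) → let (γ , [ u ]) = from (c , (δ , [ (s , s) ])) in γ , [ proj₁ u ]
    ; to-from = λ (c , δ , [ s ]) →
        cong (λ (c , (δ , [ d ])) → c , δ , [ proj₁ d ]) (to-from (c , (δ , [ (s , s) ])))
    ; from-to = λ (γ , [ s ]) → cong (λ (γ , [ u ]) → γ , [ proj₁ u ]) (from-to (γ , [ (s , s) ]))
    ; wt-to   = λ (γ , [ s ]) → weights γ [ (s , s) ]
    }
    where
    open LocalRule r
    u = letterWt ℓ
    weights : ∀ γ s → let (c , (δ , _)) = to (γ , s) in
      u ·ʷ value c +ʷ u ·ʷ (size μ ∸ size δ) ≡ u ·ʷ (size γ ∸ size μ)
    weights γ s with to (γ , s) | sizes (γ , s)
    ... | (c , _) , (δ , [ d ]) | e = trans (sym (·ʷ-distribˡ u c _)) (cong (u ·ʷ_)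
      (sym (excess (size γ) (size δ) (size μ) (size μ) c (strip-size (over ℓ) μ δ (proj₁ d)) e)))

Empty : Partition → Set
Empty p = ∀ i → row p i ≡ 0

empty-≡ : ∀ p → .(Empty p) → p ≡ ∅
empty-≡ p e = row-ext p ∅ λ i → recompute (_ ≟ _) (e i)

-- The head of the list is the letter whose strip is added last.
Chain : List Entry → Partition → Class
Chain []      γ = class (Irrelevant (Empty γ)) (λ _ → 0ʷ)
Chain (ℓ ∷ w) γ = ⨆[ μ ∈ Partition ] (StripClass ℓ γ μ ⊗ Chain w μ)

Crossings : Entry → List Entry → Class
Crossings ℓ []       = 𝟙
Crossings ℓ (ℓ′ ∷ w) = Crossing ℓ ℓ′ ⊗ Crossings ℓ w

empty-strip : ∀ κ γ α → Empty γ → Empty α → Strip κ (row γ) (row α)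
empty-strip false γ α e f i = ≤-reflexive (trans (f i) (sym (e i))) , ≤-reflexive (trans (e (suc i)) (sym (f i)))
empty-strip true  γ α e f i = ≤-reflexive (trans (f i) (sym (e i))) , ≤-trans (≤-reflexive (e i)) z≤n

strip-empty : ∀ κ γ α → Empty γ → Strip κ (row γ) (row α) → Empty α
strip-empty κ γ α e s i = n≤0⇒n≡0 (≤-trans (strip-⊆ κ s i) (≤-reflexive (e i)))

-- Stated for a fixed lower corner: an `exchange` leaves β joined to a new corner δ by the ℓ′-strip,
-- and the induction continues from that δ with the shorter chain. Below `∅` only the empty strip
-- remains, of weight zero.
pass-through : ∀ ℓ w δ → ⨆[ μ ∈ Partition ] (StripClass ℓ μ δ ⊗ Chain w μ) ≅ Crossings ℓ w ⊗ Chain w δ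
pass-through ℓ [] δ = record
  { to      = λ (μ , [ s ] , [ e ]) → tt , [ strip-empty (over ℓ) μ δ e s ]
  ; from    = λ (_ , [ e ]) → ∅ , [ empty-strip (over ℓ) ∅ δ (λ _ → refl) e ] , [ (λ _ → refl) ]
  ; to-from = λ _ → refl
  ; from-to = λ (μ , [ s ] , [ e ]) → sameEmpty (empty-≡ μ e)
  ; wt-to   = λ (μ , [ s ] , [ e ]) → sym (trans (+ʷ-identityʳ _)
      (trans (cong (λ μ → letterWt ℓ ·ʷ (size μ ∸ size δ)) (empty-≡ μ e))
        (trans (cong (letterWt ℓ ·ʷ_) (0∸n≡0 (size δ))) (·ʷ-zeroʳ (letterWt ℓ)))))
  }
  where
  sameEmpty : ∀ {μ} {s : Irrelevant (Strip (over ℓ) (row μ) (row δ))} {e : Irrelevant (Empty μ)}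
    {s′ : Irrelevant (Strip (over ℓ) (row ∅) (row δ))} {e′ : Irrelevant (Empty ∅)} →
    μ ≡ ∅ → _≡_ {A = Carrier (⨆[ μ ∈ Partition ] (StripClass ℓ μ δ ⊗ Chain [] μ))}
      (∅ , s′ , e′) (μ , s , e)
  sameEmpty refl = refl
pass-through ℓ (ℓ′ ∷ w) β = begin
  (⨆[ γ ∈ Partition ] (StripClass ℓ γ β ⊗ (⨆[ α ∈ Partition ] (StripClass ℓ′ γ α ⊗ Chain w α))))
    ≈⟨ iso (λ (γ , s , α , t , c) → α , (γ , s , t) , c) (λ (α , (γ , s , t) , c) → γ , s , α , t , c)
         (λ _ → refl) (λ _ → refl) (λ (γ , s , α , t , c) →
           +ʷ-assoc (wt (StripClass ℓ γ β) s) (wt (StripClass ℓ′ γ α) t) (wt (Chain w α) c)) ⟩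
  (⨆[ α ∈ Partition ] ((⨆[ γ ∈ Partition ] (StripClass ℓ γ β ⊗ StripClass ℓ′ γ α)) ⊗ Chain w α))
    ≈⟨ ⨆-cong (λ α → ⊗-cong (exchange ℓ ℓ′ α β) ≅-refl) ⟩
  (⨆[ α ∈ Partition ] ((Crossing ℓ ℓ′ ⊗ (⨆[ δ ∈ Partition ] (StripClass ℓ α δ ⊗ StripClass ℓ′ β δ))) ⊗ Chain w α))
    ≈⟨ iso (λ (α , (x , δ , s , t) , c) → x , δ , t , α , s , c)
           (λ (x , δ , t , α , s , c) → α , (x , δ , s , t) , c)
         (λ _ → refl) (λ _ → refl) (λ (α , (x , δ , s , t) , c) → rearrange
           (wt (Crossing ℓ ℓ′) x) (wt (StripClass ℓ α δ) s) (wt (StripClass ℓ′ β δ) t) (wt (Chain w α) c)) ⟩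
  (Crossing ℓ ℓ′ ⊗ (⨆[ δ ∈ Partition ] (StripClass ℓ′ β δ ⊗ (⨆[ α ∈ Partition ] (StripClass ℓ α δ ⊗ Chain w α)))))
    ≈⟨ ⊗-congʳ (Crossing ℓ ℓ′) (⨆-cong λ δ → ⊗-congʳ (StripClass ℓ′ β δ) (pass-through ℓ w δ)) ⟩
  (Crossing ℓ ℓ′ ⊗ (⨆[ δ ∈ Partition ] (StripClass ℓ′ β δ ⊗ (Crossings ℓ w ⊗ Chain w δ))))
    ≈⟨ iso (λ (x , δ , t , y , c) → (x , y) , δ , t , c) (λ ((x , y) , δ , t , c) → x , δ , t , y , c)
         (λ _ → refl) (λ _ → refl) (λ (x , δ , t , y , c) → rearrange′
           (wt (Crossing ℓ ℓ′) x) (wt (StripClass ℓ′ β δ) t) (wt (Crossings ℓ w) y) (wt (Chain w δ) c)) ⟩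
  ((Crossing ℓ ℓ′ ⊗ Crossings ℓ w) ⊗ Chain (ℓ′ ∷ w) β) ∎
  where
  open import Relation.Binary.Reasoning.Setoid ⊗.setoid
  open +ʷ-Solver renaming (_⊕_ to _⊙_)
  rearrange : ∀ x s t c → x +ʷ (t +ʷ (s +ʷ c)) ≡ (x +ʷ (s +ʷ t)) +ʷ c
  rearrange = solve 4 (λ x s t c → x ⊙ (t ⊙ (s ⊙ c)) ⊜ (x ⊙ (s ⊙ t)) ⊙ c) refl
  rearrange′ : ∀ x t y c → (x +ʷ y) +ʷ (t +ʷ c) ≡ x +ʷ (t +ʷ (y +ʷ c))
  rearrange′ = solve 4 (λ x t y c → (x ⊙ y) ⊙ (t ⊙ c) ⊜ x ⊙ (t ⊙ (y ⊙ c))) refl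

Chains : List Entry → Class
Chains w = ⨆ Partition (Chain w)

Expansion : List Entry → Class
Expansion []      = 𝟙
Expansion (ℓ ∷ w) = (Repeats ℓ ⊗ Crossings ℓ w) ⊗ Expansion w

chains-expansion : ∀ w → Chains w ≅ Expansion w
chains-expansion [] = record
  { to      = λ _ → tt
  ; from    = λ _ → ∅ , [ (λ _ → refl) ]
  ; to-from = λ _ → refl
  ; from-to = λ (μ , [ e ]) → sameEmpty (empty-≡ μ e)
  ; wt-to   = λ _ → refl
  }
  where
  sameEmpty : ∀ {μ} {e : Irrelevant (Empty μ)} {e′ : Irrelevant (Empty ∅)} →
    μ ≡ ∅ → _≡_ {A = Carrier (Chains [])} (∅ , e′) (μ , e)
  sameEmpty refl = refl
chains-expansion (ℓ ∷ w) = begin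
  (⨆[ γ ∈ Partition ] ⨆[ μ ∈ Partition ] (StripClass ℓ γ μ ⊗ Chain w μ))
    ≈⟨ iso (λ (γ , μ , s , c) → μ , (γ , s) , c) (λ (μ , (γ , s) , c) → γ , μ , s , c)
         (λ _ → refl) (λ _ → refl) (λ _ → refl) ⟩
  (⨆[ μ ∈ Partition ] ((⨆[ γ ∈ Partition ] StripClass ℓ γ μ) ⊗ Chain w μ))
    ≈⟨ ⨆-cong (λ μ → ⊗-cong (reflect ℓ μ) ≅-refl) ⟩
  (⨆[ μ ∈ Partition ] ((Repeats ℓ ⊗ (⨆[ δ ∈ Partition ] StripClass ℓ μ δ)) ⊗ Chain w μ))
    ≈⟨ iso (λ (μ , (x , δ , s) , c) → x , δ , μ , s , c) (λ (x , δ , μ , s , c) → μ , (x , δ , s) , c)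
         (λ _ → refl) (λ _ → refl) (λ (μ , (x , δ , s) , c) →
           sym (+ʷ-assoc (wt (Repeats ℓ) x) (wt (StripClass ℓ μ δ) s) (wt (Chain w μ) c))) ⟩
  (Repeats ℓ ⊗ (⨆[ δ ∈ Partition ] ⨆[ μ ∈ Partition ] (StripClass ℓ μ δ ⊗ Chain w μ)))
    ≈⟨ ⊗-congʳ (Repeats ℓ) (⨆-cong (pass-through ℓ w)) ⟩
  (Repeats ℓ ⊗ (⨆[ δ ∈ Partition ] (Crossings ℓ w ⊗ Chain w δ)))
    ≈⟨ iso (λ (x , δ , y , c) → (x , y) , δ , c) (λ ((x , y) , δ , c) → x , δ , y , c)
         (λ _ → refl) (λ _ → refl) (λ (x , δ , y , c) →
           +ʷ-assoc (wt (Repeats ℓ) x) (wt (Crossings ℓ w) y) (wt (Chain w δ) c)) ⟩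
  ((Repeats ℓ ⊗ Crossings ℓ w) ⊗ Chains w)
    ≈⟨ ⊗-congʳ (Repeats ℓ ⊗ Crossings ℓ w) (chains-expansion w) ⟩
  ((Repeats ℓ ⊗ Crossings ℓ w) ⊗ Expansion w) ∎
  where open import Relation.Binary.Reasoning.Setoid ⊗.setoid

-- Rearranging the product

module R = SetoidReasoning ⊗.setoid

∏ : List ℕ → (ℕ → Class) → Class
∏ xs f = foldr _⊗_ 𝟙 (map f xs)

-- The strict triangle: one factor for every unordered pair of positions, as for letters of two
-- different values that cross once.
Δ : List ℕ → (ℕ → Class) → Class
Δ []       f = 𝟙
Δ (x ∷ xs) f = ∏ xs (λ y → f (x + y)) ⊗ Δ xs f

∏-cong : ∀ xs {f g} → (∀ x → f x ≅ g x) → ∏ xs f ≅ ∏ xs g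
∏-cong []       h = ≅-refl
∏-cong (x ∷ xs) h = ⊗-cong (h x) (∏-cong xs h)

≡⇒≅ : {X Y : Class} → X ≡ Y → X ≅ Y
≡⇒≅ refl = ≅-refl

interchange : ∀ X Y Z W → (X ⊗ Y) ⊗ (Z ⊗ W) ≅ (X ⊗ Z) ⊗ (Y ⊗ W)
interchange = solve 4 (λ x y z w → (x ⊙ y) ⊙ (z ⊙ w) ⊜ (x ⊙ z) ⊙ (y ⊙ w)) ≅-refl
  where open ⊗-Solver renaming (_⊕_ to _⊙_)

∏-⊗ : ∀ xs f g → ∏ xs (λ x → f x ⊗ g x) ≅ ∏ xs f ⊗ ∏ xs g
∏-⊗ []       f g = ≅-sym (⊗.identityˡ 𝟙)
∏-⊗ (x ∷ xs) f g = ≅-trans (⊗-congʳ (f x ⊗ g x) (∏-⊗ xs f g))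
  (interchange (f x) (g x) (∏ xs f) (∏ xs g))

Δ-⊗ : ∀ xs f g → Δ xs (λ s → f s ⊗ g s) ≅ Δ xs f ⊗ Δ xs g
Δ-⊗ []       f g = ≅-sym (⊗.identityˡ 𝟙)
Δ-⊗ (x ∷ xs) f g = ≅-trans (⊗-cong (∏-⊗ xs _ _) (Δ-⊗ xs f g))
  (interchange (∏ xs (λ y → f (x + y))) (∏ xs (λ y → g (x + y))) (Δ xs f) (Δ xs g))

∏-∷ʳ : ∀ xs x f → ∏ (xs ∷ʳ x) f ≅ ∏ xs f ⊗ f x
∏-∷ʳ []       x f = ⊗.comm (f x) 𝟙
∏-∷ʳ (y ∷ xs) x f = ≅-trans (⊗-congʳ (f y) (∏-∷ʳ xs x f)) (≅-sym (⊗.assoc (f y) (∏ xs f) (f x)))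

Δ-∷ʳ : ∀ xs x f → Δ (xs ∷ʳ x) f ≅ Δ xs f ⊗ ∏ xs (λ y → f (y + x))
Δ-∷ʳ []       x f = ≅-refl
Δ-∷ʳ (y ∷ xs) x f = ≅-trans (⊗-cong (∏-∷ʳ xs x _) (Δ-∷ʳ xs x f))
  (interchange (∏ xs (λ z → f (y + z))) (f (y + x)) (Δ xs f) _)

-- The factor depends only on the sum of the indices, so the two halves off the diagonal coincide.
-- For 1 + a q^(i+j) they match the two mixed crossings of each pair of values.
∏-square : ∀ xs f → ∏ xs (λ x → ∏ xs (λ y → f (y + x))) ≅ ∏ xs (λ x → f (x + x)) ⊗ (Δ xs f ⊗ Δ xs f)
∏-square []       f = solve 0 (ide ⊜ ide ⊙ (ide ⊙ ide)) ≅-refl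
  where open ⊗-Solver renaming (id to ide; _⊕_ to _⊙_)
∏-square (x ∷ xs) f = begin
  (f (x + x) ⊗ ∏ xs (λ y → f (y + x))) ⊗ ∏ xs (λ z → f (x + z) ⊗ ∏ xs (λ y → f (y + z)))
    ≈⟨ ⊗-cong (⊗-congʳ (f (x + x)) (∏-cong xs λ y → ≡⇒≅ (cong f (+-comm y x)))) (∏-⊗ xs _ _) ⟩
  (f (x + x) ⊗ p) ⊗ (p ⊗ ∏ xs (λ z → ∏ xs (λ y → f (y + z))))
    ≈⟨ ⊗-congʳ (f (x + x) ⊗ p) (⊗-congʳ p (∏-square xs f)) ⟩
  (f (x + x) ⊗ p) ⊗ (p ⊗ (q ⊗ (Δ xs f ⊗ Δ xs f)))
    ≈⟨ solve 4 (λ a p q d → (a ⊙ p) ⊙ (p ⊙ (q ⊙ (d ⊙ d))) ⊜ (a ⊙ q) ⊙ ((p ⊙ d) ⊙ (p ⊙ d)))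
         ≅-refl (f (x + x)) p q (Δ xs f) ⟩
  (f (x + x) ⊗ q) ⊗ ((p ⊗ Δ xs f) ⊗ (p ⊗ Δ xs f)) ∎
  where
  open R
  open ⊗-Solver renaming (_⊕_ to _⊙_)
  p = ∏ xs (λ y → f (x + y))
  q = ∏ xs (λ y → f (y + y))

oneTo-∷ʳ : ∀ n → oneTo (suc n) ≡ oneTo n ∷ʳ suc n
oneTo-∷ʳ n = trans (map-upTo suc (suc n)) (trans (sym (applyUpTo-∷ʳ suc n))
  (cong (_∷ʳ suc n) (sym (map-upTo suc n))))

upTo-∷ : ∀ n → upTo (suc n) ≡ 0 ∷ oneTo n
upTo-∷ n = cong (0 ∷_) (sym (map-upTo suc n))

∏-map-suc : ∀ xs f → ∏ (map suc xs) f ≡ ∏ xs (f ∘ suc)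
∏-map-suc []       f = refl
∏-map-suc (x ∷ xs) f = cong (f (suc x) ⊗_) (∏-map-suc xs f)

∏-upTo : ∀ n f → ∏ (upTo (suc n)) f ≅ f 0 ⊗ ∏ (oneTo n) f
∏-upTo n f = ≡⇒≅ (cong (λ xs → ∏ xs f) (upTo-∷ n))

∏-triangle : ∀ n h → ∏ (oneTo n) (λ j → ∏ (oneTo j) (λ i → h (i + j)))
  ≅ ∏ (oneTo n) (λ j → h (j + j)) ⊗ Δ (oneTo n) h
∏-triangle zero    h = ≅-sym (⊗.identityˡ 𝟙)
∏-triangle (suc n) h = subst
  (λ ys → ∏ ys (λ j → ∏ (oneTo j) (λ i → h (i + j))) ≅ ∏ ys (λ j → h (j + j)) ⊗ Δ ys h)
  (sym (oneTo-∷ʳ n)) $ begin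
  ∏ (xs ∷ʳ suc n) (λ j → ∏ (oneTo j) (λ i → h (i + j)))
    ≈⟨ ∏-∷ʳ xs (suc n) _ ⟩
  ∏ xs (λ j → ∏ (oneTo j) (λ i → h (i + j))) ⊗ ∏ (oneTo (suc n)) (λ i → h (i + suc n))
    ≈⟨ ⊗-cong (∏-triangle n h) (≡⇒≅ (cong (λ ys → ∏ ys (λ i → h (i + suc n))) (oneTo-∷ʳ n))) ⟩
  (q ⊗ Δ xs h) ⊗ ∏ (xs ∷ʳ suc n) (λ i → h (i + suc n))
    ≈⟨ ⊗-congʳ (q ⊗ Δ xs h) (∏-∷ʳ xs (suc n) _) ⟩
  (q ⊗ Δ xs h) ⊗ (p ⊗ h (suc n + suc n))
    ≈⟨ solve 4 (λ q d p a → (q ⊙ d) ⊙ (p ⊙ a) ⊜ (q ⊙ a) ⊙ (d ⊙ p)) ≅-refl q (Δ xs h) p (h (suc n + suc n)) ⟩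
  (q ⊗ h (suc n + suc n)) ⊗ (Δ xs h ⊗ p)
    ≈⟨ ⊗-cong (∏-∷ʳ xs (suc n) (λ j → h (j + j))) (Δ-∷ʳ xs (suc n) h) ⟨
  ∏ (xs ∷ʳ suc n) (λ j → h (j + j)) ⊗ Δ (xs ∷ʳ suc n) h ∎
  where
  open R
  open ⊗-Solver renaming (_⊕_ to _⊙_)
  xs = oneTo n
  p = ∏ xs (λ i → h (i + suc n))
  q = ∏ xs (λ j → h (j + j))

-- Shifting i down by one gives the range 0 ≤ i < j: the line i = 0 contributes the single factors
-- `h j`, the rest is the strict triangle.
∏-shifted-triangle : ∀ n h → ∏ (oneTo n) (λ j → ∏ (oneTo j) (λ i → h (i + j ∸ 1)))
  ≅ ∏ (oneTo n) h ⊗ Δ (oneTo n) h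
∏-shifted-triangle zero    h = ≅-sym (⊗.identityˡ 𝟙)
∏-shifted-triangle (suc n) h = subst
  (λ ys → ∏ ys (λ j → ∏ (oneTo j) (λ i → h (i + j ∸ 1))) ≅ ∏ ys h ⊗ Δ ys h)
  (sym (oneTo-∷ʳ n)) $ begin
  ∏ (xs ∷ʳ suc n) (λ j → ∏ (oneTo j) (λ i → h (i + j ∸ 1)))
    ≈⟨ ∏-∷ʳ xs (suc n) _ ⟩
  ∏ xs (λ j → ∏ (oneTo j) (λ i → h (i + j ∸ 1))) ⊗ ∏ (oneTo (suc n)) (λ i → h (i + suc n ∸ 1))
    ≈⟨ ⊗-cong (∏-shifted-triangle n h) (≡⇒≅ (∏-map-suc (upTo (suc n)) _)) ⟩
  (q ⊗ Δ xs h) ⊗ ∏ (upTo (suc n)) (λ i → h (i + suc n))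
    ≈⟨ ⊗-congʳ (q ⊗ Δ xs h) (∏-upTo n _) ⟩
  (q ⊗ Δ xs h) ⊗ (h (suc n) ⊗ p)
    ≈⟨ solve 4 (λ q d p a → (q ⊙ d) ⊙ (a ⊙ p) ⊜ (q ⊙ a) ⊙ (d ⊙ p)) ≅-refl q (Δ xs h) p (h (suc n)) ⟩
  (q ⊗ h (suc n)) ⊗ (Δ xs h ⊗ p)
    ≈⟨ ⊗-cong (∏-∷ʳ xs (suc n) h) (Δ-∷ʳ xs (suc n) h) ⟨
  ∏ (xs ∷ʳ suc n) h ⊗ Δ (xs ∷ʳ suc n) h ∎
  where
  open R
  open ⊗-Solver renaming (_⊕_ to _⊙_)
  xs = oneTo n
  p = ∏ xs (λ i → h (i + suc n))
  q = ∏ xs h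

Geom AtMostOne : ℕ → ℕ → Class
Geom      b e = Multiples (λ _ → ⊤) (b , e)
AtMostOne b e = Multiples (_≤ 1)    (b , e)

-- Division of the multiplicity by 2 with remainder is the bijective form of 1/(1 - x) = (1 + x)/(1
-- - x²).
geom-split : ∀ b e → Geom b e ≅ AtMostOne b e ⊗ Geom (b + b) (e + e)
geom-split b e = record
  { to      = λ (c , _) → (c % 2 , [ ≤-pred (m%n<n c 2) ]) , (c / 2 , [ tt ])
  ; from    = λ ((r , _) , (t , _)) → r + t * 2 , [ tt ]
  ; to-from = λ ((r , [ r≤1 ]) , (t , _)) → to-from r t r≤1
  ; from-to = λ (c , _) → refinement-≡ (sym (m≡m%n+[m/n]*n c 2))
  ; wt-to   = λ (c , _) → cong₂ _,_ (halves b c) (halves e c)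
  }
  where
  to-from : ∀ r t → .(r≤1 : r ≤ 1) → _≡_ {A = Refinement ℕ (_≤ 1) × Refinement ℕ (λ _ → ⊤)}
    (((r + t * 2) % 2 , [ ≤-pred (m%n<n (r + t * 2) 2) ]) , ((r + t * 2) / 2 , [ tt ]))
    ((r , [ r≤1 ]) , (t , [ tt ]))
  to-from r t r≤1 = cong₂ _,_ (refinement-≡ mod)
      (refinement-≡ (*-cancelʳ-≡ ((r + t * 2) / 2) t 2 (+-cancelˡ-≡ r _ _
        (trans (cong (_+ (r + t * 2) / 2 * 2) (sym mod)) (sym (m≡m%n+[m/n]*n (r + t * 2) 2))))))
    where
    mod : (r + t * 2) % 2 ≡ r
    mod = trans ([m+kn]%n≡m%n r t 2) (m<n⇒m%n≡m (s≤s (recompute (r ≤? 1) r≤1)))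
  halves : ∀ x c → x * (c % 2) + (x + x) * (c / 2) ≡ x * c
  halves x c = trans (solve 3 (λ x r t → x :* r :+ (x :+ x) :* t := x :* (r :+ t :* con 2)) refl x (c % 2) (c / 2))
    (cong (x *_) (sym (m≡m%n+[m/n]*n c 2)))
    where open +-*-Solver

-- On an increasing list this is the reading order reversed, in accordance with `Chain`: the head 1̄
-- is added last.
word : List ℕ → List Entry
word []       = []
word (x ∷ xs) = (x , true) ∷ (x , false) ∷ word xs

crossings-word : ∀ ℓ xs → Crossings ℓ (word xs)
  ≅ ∏ xs (λ y → Crossing ℓ (y , true) ⊗ Crossing ℓ (y , false))
crossings-word ℓ []       = ≅-refl
crossings-word ℓ (y ∷ xs) = ≅-trans
  (≅-sym (⊗.assoc (Crossing ℓ (y , true)) (Crossing ℓ (y , false)) (Crossings ℓ (word xs))))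
  (⊗-congʳ (Crossing ℓ (y , true) ⊗ Crossing ℓ (y , false)) (crossings-word ℓ xs))

-- The letters j̄ and j contribute their two reflections and their mutual crossing 1 + a q^(2j); two
-- different values contribute four crossings, collected under `Δ`. That each `Repeats` and
-- `Crossing` is one of `Geom` and `AtMostOne` holds by computation.
expansion-word : ∀ xs → Expansion (word xs)
  ≅ ∏ xs (λ x → Geom 1 x ⊗ (Geom 0 x ⊗ AtMostOne 1 (x + x)))
  ⊗ Δ xs (λ s → (Geom 2 s ⊗ AtMostOne 1 s) ⊗ (AtMostOne 1 s ⊗ Geom 0 s))
expansion-word []       = ≅-sym (⊗.identityˡ 𝟙)
expansion-word (x ∷ xs) = begin
  (Geom 1 x ⊗ (AtMostOne 1 (x + x) ⊗ Crossings (x , true) (word xs)))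
    ⊗ ((Geom 0 x ⊗ Crossings (x , false) (word xs)) ⊗ Expansion (word xs))
    ≈⟨ ⊗-cong (⊗-congʳ (Geom 1 x) (⊗-congʳ (AtMostOne 1 (x + x)) (crossings-word (x , true) xs)))
              (⊗-cong (⊗-congʳ (Geom 0 x) (crossings-word (x , false) xs)) (expansion-word xs)) ⟩
  (Geom 1 x ⊗ (AtMostOne 1 (x + x) ⊗ v)) ⊗ ((Geom 0 x ⊗ h) ⊗ (p ⊗ d))
    ≈⟨ solve 7 (λ g b v g′ h p d → (g ⊙ (b ⊙ v)) ⊙ ((g′ ⊙ h) ⊙ (p ⊙ d))
                                   ⊜ ((g ⊙ (g′ ⊙ b)) ⊙ p) ⊙ ((v ⊙ h) ⊙ d))
         ≅-refl (Geom 1 x) (AtMostOne 1 (x + x)) v (Geom 0 x) h p d ⟩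
  ((Geom 1 x ⊗ (Geom 0 x ⊗ AtMostOne 1 (x + x))) ⊗ p) ⊗ ((v ⊗ h) ⊗ d)
    ≈⟨ ⊗-congʳ ((Geom 1 x ⊗ (Geom 0 x ⊗ AtMostOne 1 (x + x))) ⊗ p)
         (⊗-cong (∏-⊗ xs (λ y → vs (x + y)) (λ y → hs (x + y))) (≅-refl {d})) ⟨
  ((Geom 1 x ⊗ (Geom 0 x ⊗ AtMostOne 1 (x + x))) ⊗ p)
    ⊗ (∏ xs (λ y → vs (x + y) ⊗ hs (x + y)) ⊗ d) ∎
  where
  open R
  open ⊗-Solver renaming (_⊕_ to _⊙_)
  vs hs : ℕ → Class
  vs s = Geom 2 s ⊗ AtMostOne 1 s
  hs s = AtMostOne 1 s ⊗ Geom 0 s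
  v = ∏ xs (λ y → vs (x + y))
  h = ∏ xs (λ y → hs (x + y))
  p = ∏ xs (λ x → Geom 1 x ⊗ (Geom 0 x ⊗ AtMostOne 1 (x + x)))
  d = Δ xs (λ s → (Geom 2 s ⊗ AtMostOne 1 s) ⊗ (AtMostOne 1 s ⊗ Geom 0 s))

rhsClass : ℕ → Class
rhsClass n = ∏ (oneTo n) λ j →
  ∏ (upTo (suc n)) (λ i → AtMostOne 1 (i + j)) ⊗ ∏ (oneTo j) (λ i → Geom 0 (i + j ∸ 1) ⊗ Geom 2 (i + j))

rhsClass-expansion : ∀ n → rhsClass n ≅ Expansion (word (oneTo n))
rhsClass-expansion n = begin
  ∏ xs (λ j → ∏ (upTo (suc n)) (pluses j) ⊗ ∏ (oneTo j) (λ i → geoms₀ j i ⊗ geoms₂ j i))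
    ≈⟨ ∏-cong xs (λ j → ⊗-cong (∏-upTo n (pluses j)) (∏-⊗ (oneTo j) (geoms₀ j) (geoms₂ j))) ⟩
  ∏ xs (λ j → (AtMostOne 1 j ⊗ ∏ xs (pluses j)) ⊗ (∏ (oneTo j) (geoms₀ j) ⊗ ∏ (oneTo j) (geoms₂ j)))
    ≈⟨ ∏-⊗ xs _ _ ⟩
  ∏ xs (λ j → AtMostOne 1 j ⊗ ∏ xs (pluses j))
    ⊗ ∏ xs (λ j → ∏ (oneTo j) (geoms₀ j) ⊗ ∏ (oneTo j) (geoms₂ j))
    ≈⟨ ⊗-cong (∏-⊗ xs _ _) (∏-⊗ xs _ _) ⟩
  (b ⊗ ∏ xs (λ j → ∏ xs (pluses j)))
    ⊗ (∏ xs (λ j → ∏ (oneTo j) (geoms₀ j)) ⊗ ∏ xs (λ j → ∏ (oneTo j) (geoms₂ j)))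
    ≈⟨ ⊗-cong (⊗-congʳ b (∏-square xs (AtMostOne 1)))
              (⊗-cong (∏-shifted-triangle n (Geom 0)) (∏-triangle n (Geom 2))) ⟩
  (b ⊗ (b₂ ⊗ (Δ xs (AtMostOne 1) ⊗ Δ xs (AtMostOne 1)))) ⊗ ((g₀ ⊗ Δ xs (Geom 0)) ⊗ (g₂ ⊗ Δ xs (Geom 2)))
    -- The factors 1 + a q^j from i = 0 are placed next to the diagonal factors 1/(1 - a² q^(2j)),
    -- which `geom-split` merges into 1/(1 - a q^j).
    ≈⟨ solve 7 (λ b b₂ d₁ g₀ d₀ g₂ d₂ → (b ⊙ (b₂ ⊙ (d₁ ⊙ d₁))) ⊙ ((g₀ ⊙ d₀) ⊙ (g₂ ⊙ d₂))
                  ⊜ ((b ⊙ g₂) ⊙ (g₀ ⊙ b₂)) ⊙ ((d₂ ⊙ d₁) ⊙ (d₁ ⊙ d₀)))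
         ≅-refl b b₂ (Δ xs (AtMostOne 1)) g₀ (Δ xs (Geom 0)) g₂ (Δ xs (Geom 2)) ⟩
  ((b ⊗ g₂) ⊗ (g₀ ⊗ b₂)) ⊗ ((Δ xs (Geom 2) ⊗ Δ xs (AtMostOne 1)) ⊗ (Δ xs (AtMostOne 1) ⊗ Δ xs (Geom 0)))
    ≈⟨ ⊗-cong (⊗-cong (≅-trans (∏-cong xs (λ x → geom-split 1 x)) (∏-⊗ xs _ _)) (∏-⊗ xs _ _))
              (⊗-cong (Δ-⊗ xs _ _) (Δ-⊗ xs _ _)) ⟨
  (∏ xs (Geom 1) ⊗ ∏ xs (λ x → Geom 0 x ⊗ AtMostOne 1 (x + x)))
    ⊗ (Δ xs (λ s → Geom 2 s ⊗ AtMostOne 1 s) ⊗ Δ xs (λ s → AtMostOne 1 s ⊗ Geom 0 s))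
    ≈⟨ ⊗-cong (∏-⊗ xs _ _) (Δ-⊗ xs _ _) ⟨
  ∏ xs (λ x → Geom 1 x ⊗ (Geom 0 x ⊗ AtMostOne 1 (x + x)))
    ⊗ Δ xs (λ s → (Geom 2 s ⊗ AtMostOne 1 s) ⊗ (AtMostOne 1 s ⊗ Geom 0 s))
    ≈⟨ expansion-word xs ⟨
  Expansion (word xs) ∎
  where
  open R
  open ⊗-Solver renaming (_⊕_ to _⊙_)
  xs = oneTo n
  pluses geoms₀ geoms₂ : ℕ → ℕ → Class
  pluses j i = AtMostOne 1 (i + j)
  geoms₀ j i = Geom 0 (i + j ∸ 1)
  geoms₂ j i = Geom 2 (i + j)
  b  = ∏ xs (AtMostOne 1)
  b₂ = ∏ xs (λ x → AtMostOne 1 (x + x))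
  g₀ = ∏ xs (Geom 0)
  g₂ = ∏ xs (λ x → Geom 2 (x + x))

-- Coefficients as fibers

weight-irrelevant : ∀ {u v : Weight} (p q : u ≡ v) → p ≡ q
weight-irrelevant = Decidable⇒UIP.≡-irrelevant (Product.≡-dec _≟_ _≟_)

Fiber : Class → Weight → Set
Fiber X u = Σ (Carrier X) λ x → wt X x ≡ u

fiber-≡ : ∀ {X u} {p q : Fiber X u} → proj₁ p ≡ proj₁ q → p ≡ q
fiber-≡ {p = x , p} {.x , q} refl = cong (x ,_) (weight-irrelevant p q)

fiber-≅ : ∀ {X Y} → X ≅ Y → ∀ u → Fiber X u ↔ Fiber Y u
fiber-≅ {X} {Y} h u = mk↔ₛ′
  (λ (x , p) → to x , trans (wt-to x) p)
  (λ (y , p) → from y , trans (sym (wt-to (from y))) (trans (cong (wt Y) (to-from y)) p))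
  (λ (y , _) → fiber-≡ {Y} (to-from y)) (λ (x , _) → fiber-≡ {X} (from-to x))
  where open _≅_ h

-- The bridge from classes to numbers: every coefficient counts the elements of its weight, and in
-- particular there are finitely many.
Enumerates : Series → Class → Set
Enumerates S X = ∀ m k → Fin (S m k) ↔ Fiber X (m , k)

fin-sumTo : ∀ k {f : ℕ → ℕ} {F : ℕ → Set} → (∀ i → Fin (f i) ↔ F i) →
  Fin (sumTo k f) ↔ Σ ℕ (λ i → Irrelevant (i ≤ k) × F i)
fin-sumTo zero {f} {F} h = ↔-trans (h 0) (mk↔ₛ′ (λ x → 0 , [ z≤n ] , x) from to-from (λ _ → refl))
  where
  from : Σ ℕ (λ i → Irrelevant (i ≤ 0) × F i) → F 0
  from (i , [ l ] , x) = subst F (recompute (i ≟ 0) (n≤0⇒n≡0 l)) x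
  to-from : ∀ y → (0 , [ z≤n ] , from y) ≡ y
  to-from (zero , [ l ] , x) = refl
  to-from (suc i , [ l ] , x) = contradiction (recompute (suc i ≤? 0) l) λ ()
fin-sumTo (suc k) {f} {F} h =
  ↔-trans +↔⊎ (↔-trans (fin-sumTo k h ⊎-↔ h (suc k)) (mk↔ₛ′ to from to-from from-to))
  where
  Prev Upto : Set
  Prev = Σ ℕ (λ i → Irrelevant (i ≤ k) × F i)
  Upto = Σ ℕ (λ i → Irrelevant (i ≤ suc k) × F i)
  to : Prev ⊎ F (suc k) → Upto
  to (inj₁ (i , [ l ] , x)) = i , [ m≤n⇒m≤1+n l ] , x
  to (inj₂ x)               = suc k , [ ≤-refl ] , x
  from : Upto → Prev ⊎ F (suc k)
  from (i , [ l ] , x) with i ≟ suc k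
  ... | yes refl = inj₂ x
  ... | no  i≢   = inj₁ (i , [ ≤-pred (≤∧≢⇒< l i≢) ] , x)
  to-from : ∀ y → to (from y) ≡ y
  to-from (i , [ l ] , x) with i ≟ suc k
  ... | yes refl = refl
  ... | no  i≢   = refl
  from-to : ∀ y → from (to y) ≡ y
  from-to (inj₁ (i , [ l ] , x)) with i ≟ suc k
  ... | yes refl = contradiction (recompute (suc k ≤? k) l) (<-irrefl refl)
  ... | no  _    = refl
  from-to (inj₂ x) with suc k ≟ suc k
  ... | yes p rewrite ≡-irrelevant p refl = refl
  ... | no  p = contradiction refl p

-- A pair is sorted by the weight of its first component. Exponents are natural numbers, so this
-- weight stays within the bounds of the Cauchy product, and the remainder is the weight of the
-- second component.
enumerates-⊛ : ∀ {f g X Y} → Enumerates f X → Enumerates g Y → Enumerates (f ⊛ g) (X ⊗ Y)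
enumerates-⊛ {f} {g} {X} {Y} hf hg m k = ↔-trans
  (fin-sumTo m (λ m₁ → fin-sumTo k (λ k₁ → ↔-trans *↔× (hf m₁ k₁ ×-↔ hg (m ∸ m₁) (k ∸ k₁)))))
  (mk↔ₛ′ to from (λ _ → fiber-≡ {X ⊗ Y} refl) from-to)
  where
  Split : Set
  Split = Σ ℕ λ m₁ → Irrelevant (m₁ ≤ m) × (Σ ℕ λ k₁ → Irrelevant (k₁ ≤ k)
            × (Fiber X (m₁ , k₁) × Fiber Y (m ∸ m₁ , k ∸ k₁)))
  to : Split → Fiber (X ⊗ Y) (m , k)
  to (m₁ , [ l ] , k₁ , [ l′ ] , (x , p) , (y , q)) = (x , y) , trans (cong₂ _+ʷ_ p q)
    (cong₂ _,_ (m+[n∸m]≡n (recompute (_ ≤? _) l)) (m+[n∸m]≡n (recompute (_ ≤? _) l′)))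
  remainder : ∀ {u v n : ℕ} → u + v ≡ n → v ≡ n ∸ u
  remainder {u} {v} refl = sym (m+n∸m≡n u v)
  from : Fiber (X ⊗ Y) (m , k) → Split
  from ((x , y) , p) =
    proj₁ (wt X x) , [ ≤-trans (m≤m+n _ _) (≤-reflexive (cong proj₁ p)) ] ,
    proj₂ (wt X x) , [ ≤-trans (m≤m+n _ _) (≤-reflexive (cong proj₂ p)) ] ,
    (x , refl) , (y , cong₂ _,_ (remainder (cong proj₁ p)) (remainder (cong proj₂ p)))
  from-to : ∀ s → from (to s) ≡ s
  from-to (m₁ , [ l ] , k₁ , [ l′ ] , (x , refl) , (y , q)) =
    cong (λ q → m₁ , [ l ] , k₁ , [ l′ ] , (x , refl) , (y , q)) (weight-irrelevant _ q)

fin-mono : ∀ b e m k → Fin (mono b e m k) ↔ ((b , e) ≡ (m , k))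
fin-mono b e m k = decide ((m ≡ᵇ b) ∧ (k ≡ᵇ e))
  (λ t → let (p , q) = Equivalence.to T-∧ t in cong₂ _,_ (sym (≡ᵇ⇒≡ m b p)) (sym (≡ᵇ⇒≡ k e q)))
  (λ where refl → Equivalence.from T-∧ (≡⇒≡ᵇ m b refl , ≡⇒≡ᵇ k e refl))
  where
  decide : ∀ t → (T t → (b , e) ≡ (m , k)) → ((b , e) ≡ (m , k) → T t) →
    Fin (if t then 1 else 0) ↔ ((b , e) ≡ (m , k))
  decide true  f g = mk↔ₛ′ (λ _ → f tt) (λ _ → zero) (λ _ → weight-irrelevant _ _) λ where zero → refl
  decide false f g = mk↔ₛ′ (λ ()) (λ p → contradiction (g p) λ ()) (λ p → contradiction (g p) λ ()) λ ()

enumerates-oneS : Enumerates oneS 𝟙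
enumerates-oneS m k = ↔-trans (fin-mono 0 0 m k)
  (mk↔ₛ′ (λ p → tt , p) proj₂ (λ _ → refl) (λ _ → refl))

enumerates-onePlus : ∀ e → Enumerates (onePlus e) (AtMostOne 1 e)
enumerates-onePlus e m k = ↔-trans +↔⊎ (↔-trans (fin-mono 0 0 m k ⊎-↔ fin-mono 1 e m k)
  (mk↔ₛ′ to from to-from from-to))
  where
  to : ((0 , 0) ≡ (m , k)) ⊎ ((1 , e) ≡ (m , k)) → Fiber (AtMostOne 1 e) (m , k)
  to (inj₁ p) = (0 , [ z≤n ]) , trans (·ʷ-zeroʳ (1 , e)) p
  to (inj₂ p) = (1 , [ ≤-refl ]) , trans (cong (1 ,_) (*-identityʳ e)) p
  from : Fiber (AtMostOne 1 e) (m , k) → ((0 , 0) ≡ (m , k)) ⊎ ((1 , e) ≡ (m , k))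
  from ((0 , _) , p) = inj₁ (trans (sym (·ʷ-zeroʳ (1 , e))) p)
  from ((1 , _) , p) = inj₂ (trans (cong (1 ,_) (sym (*-identityʳ e))) p)
  from ((2+ c , [ l ]) , p) = contradiction (recompute (2+ c ≤? 1) l) λ where (s≤s ())
  to-from : ∀ y → to (from y) ≡ y
  to-from ((0 , _) , p) = fiber-≡ {AtMostOne 1 e} refl
  to-from ((1 , _) , p) = fiber-≡ {AtMostOne 1 e} refl
  to-from ((2+ c , [ l ]) , p) = contradiction (recompute (2+ c ≤? 1) l) λ where (s≤s ())
  from-to : ∀ x → from (to x) ≡ x
  from-to (inj₁ p) = cong inj₁ (weight-irrelevant _ p)
  from-to (inj₂ p) = cong inj₂ (weight-irrelevant _ p)

enumerates-geom : ∀ b e → .{{NonZero e}} → Enumerates (geom b e) (Geom b e)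
enumerates-geom b e m k = ↔-trans (fin-sumTo k (λ t → fin-mono (b * t) (e * t) m k)) (mk↔ₛ′
  (λ (t , _ , p) → (t , [ tt ]) , p) from (λ _ → refl) (λ _ → refl))
  where
  from : Fiber (Geom b e) (m , k) →
    Σ ℕ (λ t → Irrelevant (t ≤ k) × ((b * t , e * t) ≡ (m , k)))
  from ((t , _) , p) = t , [ ≤-trans (m≤n*m t e) (≤-reflexive (cong proj₂ p)) ] , p

enumerates-∏ : ∀ {xs} f F → All (λ x → Enumerates (f x) (F x)) xs →
  Enumerates (prodS (map f xs)) (∏ xs F)
enumerates-∏ f F []       = enumerates-oneS
enumerates-∏ f F (h ∷ hs) = enumerates-⊛ h (enumerates-∏ f F hs)

enumerates-∏-oneTo : ∀ n f F → (∀ i → Enumerates (f (suc i)) (F (suc i))) →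
  Enumerates (prodS (map f (oneTo n))) (∏ (oneTo n) F)
enumerates-∏-oneTo n f F h = enumerates-∏ f F (map⁺ (All.universal h (upTo n)))

rhs-enumerates : ∀ n → Enumerates (rhs n) (rhsClass n)
rhs-enumerates n = enumerates-∏-oneTo n
  (λ j → prodS (map (pluses j) (upTo (suc n))) ⊛ prodS (map (geoms j) (oneTo j)))
  (λ j → ∏ (upTo (suc n)) (plusClasses j) ⊗ ∏ (oneTo j) (geomClasses j))
  λ j → enumerates-⊛
    (enumerates-∏ (pluses (suc j)) (plusClasses (suc j))
      (All.universal (λ i → enumerates-onePlus (i + suc j)) (upTo (suc n))))
    (enumerates-∏-oneTo (suc j) (geoms (suc j)) (geomClasses (suc j)) λ i → enumerates-⊛
      -- With both indices written as successors, the exponent `i + j ∸ 1` of the product computes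
      -- to `i + suc j`, which is positive.
      (enumerates-geom 0 (i + suc j) {{>-nonZero (≤-trans (s≤s z≤n) (m≤n+m (suc j) i))}})
      (enumerates-geom 2 (suc i + suc j)))
  where
  pluses geoms : ℕ → ℕ → Series
  pluses j i = onePlus (i + j)
  geoms  j i = geom 0 (i + j ∸ 1) ⊛ geom 2 (i + j)
  plusClasses geomClasses : ℕ → ℕ → Class
  plusClasses j i = AtMostOne 1 (i + j)
  geomClasses j i = Geom 0 (i + j ∸ 1) ⊗ Geom 2 (i + j)

-- Tableaux and chains

_≟ᵉ_ : DecidableEquality Entry
_≟ᵉ_ = Product.≡-dec _≟_ Bool._≟_

-- Conditions (1) and (2) for two entries, joined with weak decrease. `RowRel ℓ ℓ` fails for an
-- overlined letter and `ColRel ℓ ℓ` for a non-overlined one; this is the source of the two kinds of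
-- strips.
RowRel ColRel : Entry → Entry → Set
RowRel x y = val y < val x ⊎ (val y ≡ val x × over x ≡ false)
ColRel x y = val y < val x ⊎ (val y ≡ val x × over y ≡ true)

-- The order in which entries are added to a growing tableau: larger values first, and among equal
-- values the non-overlined ones first.
_≺_ : Entry → Entry → Set
x ≺ ℓ = val ℓ < val x ⊎ (val ℓ ≡ val x × over x ≡ false × over ℓ ≡ true)

-- An earlier letter may stand to the left of or above a later one, and by the next lemmas never the
-- other way round. Hence the cells of the last letter can be removed and leave a smaller diagram.
≺⇒row : ∀ {x ℓ} → x ≺ ℓ → RowRel x ℓ
≺⇒row (inj₁ l)           = inj₁ l
≺⇒row (inj₂ (e , f , _)) = inj₂ (e , f)

≺⇒col : ∀ {x ℓ} → x ≺ ℓ → ColRel x ℓ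
≺⇒col (inj₁ l)           = inj₁ l
≺⇒col (inj₂ (e , _ , t)) = inj₂ (e , t)

≺⇒¬row : ∀ {x ℓ} → x ≺ ℓ → ¬ RowRel ℓ x
≺⇒¬row (inj₁ l)           (inj₁ l′)      = <-asym l l′
≺⇒¬row (inj₁ l)           (inj₂ (e , _)) = <-irrefl (sym e) l
≺⇒¬row (inj₂ (e , _))     (inj₁ l)       = <-irrefl (sym e) l
≺⇒¬row (inj₂ (_ , _ , t)) (inj₂ (_ , f)) = contradiction (trans (sym t) f) λ ()

≺⇒¬col : ∀ {x ℓ} → x ≺ ℓ → ¬ ColRel ℓ x
≺⇒¬col (inj₁ l)           (inj₁ l′)      = <-asym l l′
≺⇒¬col (inj₁ l)           (inj₂ (e , _)) = <-irrefl (sym e) l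
≺⇒¬col (inj₂ (e , _))     (inj₁ l)       = <-irrefl (sym e) l
≺⇒¬col (inj₂ (_ , f , _)) (inj₂ (_ , t)) = contradiction (trans (sym t) f) λ ()

≺-irrefl : ∀ {x} → ¬ x ≺ x
≺-irrefl (inj₁ l)           = <-irrefl refl l
≺-irrefl (inj₂ (_ , f , t)) = contradiction (trans (sym t) f) λ ()

-- Only vertical neighbours are related. Since columns decrease, equal values in a column are
-- contiguous, so this captures condition (2).
data Stacked : List Entry → List Entry → Set where
  []  : ∀ {r} → Stacked r []
  _∷_ : ∀ {x y r s} → ColRel x y → Stacked r s → Stacked (x ∷ r) (y ∷ s)

stacked-length : ∀ {r s} → Stacked r s → length s ≤ length r
stacked-length []      = z≤n
stacked-length (_ ∷ s) = s≤s (stacked-length s)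

record RowOver (w : List Entry) (r : List Entry) : Set where
  constructor _,_
  field
    sorted  : AllPairs RowRel r
    letters : All (_∈ w) r
open RowOver

-- Peeling the last letter off a tableau

prefix : Entry → List Entry → List Entry
prefix ℓ []      = []
prefix ℓ (x ∷ r) with x ≟ᵉ ℓ
... | yes _ = []
... | no  _ = x ∷ prefix ℓ r

extend : Entry → List Entry → ℕ → List Entry
extend ℓ r l = r ++ replicate (l ∸ length r) ℓ

∈-tail : ∀ {x ℓ : Entry} {w} → x ≢ ℓ → x ∈ (ℓ ∷ w) → x ∈ w
∈-tail n (here e)  = contradiction e n
∈-tail n (there p) = p

module Peel (ℓ : Entry) (w : List Entry) (last : All (_≺ ℓ) w) where

  ≺ℓ : ∀ {x} → x ∈ w → x ≺ ℓ
  ≺ℓ = All.lookup last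

  ℓ∉w : ∀ {x} → x ∈ w → x ≢ ℓ
  ℓ∉w p refl = ≺-irrefl (≺ℓ p)

  prefix-length : ∀ r → length (prefix ℓ r) ≤ length r
  prefix-length []      = z≤n
  prefix-length (x ∷ r) with x ≟ᵉ ℓ
  ... | yes _ = z≤n
  ... | no  _ = s≤s (prefix-length r)

  prefix-All : ∀ {P : Entry → Set} {r} → All P r → All P (prefix ℓ r)
  prefix-All []                = []
  prefix-All {r = x ∷ r} (p ∷ ps) with x ≟ᵉ ℓ
  ... | yes _ = []
  ... | no  _ = p ∷ prefix-All ps

  prefix-row : ∀ {r} → RowOver (ℓ ∷ w) r → RowOver w (prefix ℓ r)
  prefix-row ([] , [])           = [] , []
  prefix-row {x ∷ r} (s ∷ ss , i ∷ is) with x ≟ᵉ ℓ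
  ... | yes _ = [] , []
  ... | no  n = let (ss′ , is′) = prefix-row (ss , is) in prefix-All s ∷ ss′ , ∈-tail n i ∷ is′

  -- No letter of `w` may stand to the right of `ℓ`. Cutting a row at its first `ℓ` therefore
  -- forgets nothing but the length of the row.
  after-ℓ : ∀ {r} → All (RowRel ℓ) r → All (_∈ (ℓ ∷ w)) r → r ≡ replicate (length r) ℓ
  after-ℓ []       []             = refl
  after-ℓ (p ∷ ps) (here refl ∷ is) = cong (ℓ ∷_) (after-ℓ ps is)
  after-ℓ (p ∷ ps) (there i ∷ is)   = contradiction p (≺⇒¬row (≺ℓ i))

  extend-prefix : ∀ {r} → RowOver (ℓ ∷ w) r → extend ℓ (prefix ℓ r) (length r) ≡ r
  extend-prefix ([] , [])             = refl
  extend-prefix {x ∷ r} (s ∷ ss , i ∷ is) with x ≟ᵉ ℓ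
  ... | yes refl = cong (ℓ ∷_) (sym (after-ℓ s is))
  ... | no  n    = cong (x ∷_) (extend-prefix (ss , is))

  row-vertical : ∀ {r} → over ℓ ≡ true → RowOver (ℓ ∷ w) r → length r ≤ suc (length (prefix ℓ r))
  row-vertical t ([] , [])             = z≤n
  row-vertical {x ∷ r} t (s ∷ ss , i ∷ is) with x ≟ᵉ ℓ
  ... | no  n = s≤s (row-vertical t (ss , is))
  ... | yes refl with s | is
  ...   | [] | _ = ≤-refl
  ...   | inj₁ l ∷ _ | here refl ∷ _ = contradiction l (<-irrefl refl)
  ...   | inj₂ (_ , f) ∷ _ | here refl ∷ _ = contradiction (trans (sym t) f) λ ()
  ...   | p ∷ _ | there i ∷ _ = contradiction p (≺⇒¬row (≺ℓ i))

  prefix-stacked : ∀ {r s} → All (_∈ (ℓ ∷ w)) s → Stacked r s → Stacked (prefix ℓ r) (prefix ℓ s)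
  prefix-stacked [] [] = []
  prefix-stacked {x ∷ r} {y ∷ s} (i ∷ is) (c ∷ cs) with y ≟ᵉ ℓ
  ... | yes _ = []
  ... | no  n with x ≟ᵉ ℓ
  ...   | yes refl = contradiction c (≺⇒¬col (≺ℓ (∈-tail n i)))
  ...   | no  _    = c ∷ prefix-stacked is cs

  stacked-horizontal : ∀ {r s} → over ℓ ≡ false → All (_∈ (ℓ ∷ w)) s → Stacked r s →
    length s ≤ length (prefix ℓ r)
  stacked-horizontal f [] [] = z≤n
  stacked-horizontal {x ∷ r} {y ∷ s} f (i ∷ is) (c ∷ cs) with x ≟ᵉ ℓ
  ... | no  _ = s≤s (stacked-horizontal f is cs)
  ... | yes refl with i | c
  ...   | there i   | c = contradiction c (≺⇒¬col (≺ℓ i))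
  ...   | here refl | inj₁ l = contradiction l (<-irrefl refl)
  ...   | here refl | inj₂ (_ , t) = contradiction (trans (sym t) f) λ ()

  prefix-++ : ∀ {r} c → All (_∈ w) r → prefix ℓ (r ++ replicate c ℓ) ≡ r
  prefix-++ zero    []       = refl
  prefix-++ (suc c) []       with ℓ ≟ᵉ ℓ
  ... | yes _ = refl
  ... | no  n = contradiction refl n
  prefix-++ {x ∷ r} c (i ∷ is) with x ≟ᵉ ℓ
  ... | yes e = contradiction e (ℓ∉w i)
  ... | no  _ = cong (x ∷_) (prefix-++ c is)

  replicate-All : ∀ {P : Entry → Set} c → P ℓ → All P (replicate c ℓ)
  replicate-All zero    p = []
  replicate-All (suc c) p = p ∷ replicate-All c p

  ++-All : ∀ {P : Entry → Set} {r} c → All P r → P ℓ → All P (r ++ replicate c ℓ)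
  ++-All c []       p = replicate-All c p
  ++-All c (q ∷ qs) p = q ∷ ++-All c qs p

  row-++ : ∀ {r} c → (over ℓ ≡ true → c ≤ 1) → RowOver w r → RowOver (ℓ ∷ w) (r ++ replicate c ℓ)
  row-++ {r} c h ρ = go ρ , ++-All c (All.map there (letters ρ)) (here refl)
    where
    block : ∀ b → over ℓ ≡ b → ∀ c → (b ≡ true → c ≤ 1) → AllPairs RowRel (replicate c ℓ)
    block b     e zero          h = []
    block b     e (suc zero)    h = [] ∷ []
    block true  e (2+ c)        h = contradiction (h refl) λ where (s≤s ())
    block false e (2+ c)        h =
      replicate-All (suc c) (inj₂ (refl , e)) ∷ block false e (suc c) λ ()
    go : ∀ {r} → RowOver w r → AllPairs RowRel (r ++ replicate c ℓ)
    go ([]     , [])     = block (over ℓ) refl c h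
    go (s ∷ ss , i ∷ is) = ++-All c s (≺⇒row (≺ℓ i)) ∷ go (ss , is)

  -- A new `ℓ` may stand under any old entry, but under a new `ℓ` only if it is overlined. For a
  -- non-overlined `ℓ` the last hypothesis, which is the interlacing of a horizontal strip, keeps
  -- the new cells of the lower row under old ones.
  stacked-++ : ∀ {r s} c d → All (_∈ w) r → Stacked r s →
    length s + d ≤ length r + c → (over ℓ ≡ false → length s + d ≤ length r) →
    Stacked (r ++ replicate c ℓ) (s ++ replicate d ℓ)
  stacked-++ c d (_ ∷ is) (p ∷ ps) l h = p ∷ stacked-++ c d is ps (≤-pred l) (≤-pred ∘ h)
  stacked-++ c d is [] l h = go c d is l h
    where
    go : ∀ {r} c d → All (_∈ w) r → d ≤ length r + c → (over ℓ ≡ false → d ≤ length r) →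
      Stacked (r ++ replicate c ℓ) (replicate d ℓ)
    go c zero is l h = []
    go c (suc d) (i ∷ is) (s≤s l) h = ≺⇒col (≺ℓ i) ∷ go c d is l (≤-pred ∘ h)
    go (suc c) (suc d) [] (s≤s l) h = below (over ℓ) refl ∷ go c d [] l λ e → ⊥-elim′ (h e)
      where
      ⊥-elim′ : ∀ {A : Set} → suc d ≤ 0 → A
      ⊥-elim′ ()
      below : ∀ b → over ℓ ≡ b → ColRel ℓ ℓ
      below true  e = inj₂ (refl , e)
      below false e = ⊥-elim′ (h e)

isNil : {A : Set} (xs : List A) → Dec (xs ≡ [])
isNil []       = yes refl
isNil (x ∷ xs) = no λ ()

module Rows = FiniteSupport {List Entry} [] isNil

rowOf : Filling → ℕ → List Entry
rowOf = at []

_≟ᶠ_ : DecidableEquality Filling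
_≟ᶠ_ = ≡-dec (≡-dec _≟ᵉ_)

record Tableau (w : List Entry) (Π : Filling) : Set where
  field
    proper  : Rows.Proper Π
    rows    : ∀ i → RowOver w (rowOf Π i)
    stacked : ∀ i → Stacked (rowOf Π i) (rowOf Π (suc i))
open Tableau

HasShape : Partition → Filling → Set
HasShape γ Π = ∀ i → length (rowOf Π i) ≡ row γ i

fillingWt : Filling → Weight
fillingWt Π = overlines Π , weight Π

Tableaux : List Entry → Class
Tableaux w = class (Refinement Filling (Tableau w)) (fillingWt ∘ value)

TableauxOf : List Entry → Partition → Class
TableauxOf w γ = class (Refinement Filling (λ Π → Tableau w Π × HasShape γ Π)) (fillingWt ∘ value)

length≡0 : ∀ {A : Set} {xs : List A} → length xs ≡ 0 → xs ≡ []
length≡0 {xs = []} e = refl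

shrinks⇒vanishing : ∀ {f : ℕ → List Entry} → Decreasing (length ∘ f) → Rows.Vanishing f
shrinks⇒vanishing d i e = length≡0 (n≤0⇒n≡0 (≤-trans (d i) (≤-reflexive (cong length e))))

entrySum : (Entry → ℕ) → Filling → ℕ
entrySum f Π = sum (map (λ r → sum (map f r)) Π)

entrySum-Σ : ∀ f Π {N} → length Π ≤ N → entrySum f Π ≡ Σ< N (λ i → sum (map f (rowOf Π i)))
entrySum-Σ f []      {zero}  l       = refl
entrySum-Σ f []      {suc N} l       = entrySum-Σ f [] {N} z≤n
entrySum-Σ f (r ∷ Π) {suc N} (s≤s l) = cong (sum (map f r) +_) (entrySum-Σ f Π l)

Σ<-* : ∀ N k (f : ℕ → ℕ) → Σ< N (λ i → k * f i) ≡ k * Σ< N f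
Σ<-* zero    k f = sym (*-zeroʳ k)
Σ<-* (suc N) k f = trans (cong (k * f 0 +_) (Σ<-* N k (f ∘ suc))) (sym (*-distribˡ-+ k (f 0) _))

Σ<-∸ : ∀ N {f g : ℕ → ℕ} → (∀ i → g i ≤ f i) → Σ< N (λ i → f i ∸ g i) ≡ Σ< N f ∸ Σ< N g
Σ<-∸ N {f} {g} h = sym (trans (cong (_∸ Σ< N g) (trans (Σ<-cong N (λ i → sym (m∸n+n≡m (h i))))
  (Σ<-+ N (λ i → f i ∸ g i) g))) (m+n∸n≡m _ (Σ< N g)))

sum-replicate : ∀ c x → sum (replicate c x) ≡ x * c
sum-replicate zero    x = sym (*-zeroʳ x)
sum-replicate (suc c) x = trans (cong (x +_) (sum-replicate c x)) (sym (*-suc x c))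

sum-extend : ∀ f ℓ r l → sum (map f (extend ℓ r l)) ≡ f ℓ * (l ∸ length r) + sum (map f r)
sum-extend f ℓ r l = begin
  sum (map f (r ++ replicate c ℓ))             ≡⟨ cong sum (map-++ f r _) ⟩
  sum (map f r ++ map f (replicate c ℓ))       ≡⟨ sum-++ (map f r) _ ⟩
  sum (map f r) + sum (map f (replicate c ℓ))  ≡⟨ cong (λ xs → sum (map f r) + sum xs) (map-replicate f c ℓ) ⟩
  sum (map f r) + sum (replicate c (f ℓ))      ≡⟨ cong (sum (map f r) +_) (sum-replicate c (f ℓ)) ⟩
  sum (map f r) + f ℓ * c                      ≡⟨ +-comm (sum (map f r)) _ ⟩
  f ℓ * c + sum (map f r)                      ∎
  where
  open ≡-Reasoning
  c = l ∸ length r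

module PeelTableau (ℓ : Entry) (w : List Entry) (last : All (_≺ ℓ) w) where
  open Peel ℓ w last

  module _ (Π : Filling) (t : Tableau (ℓ ∷ w) Π) where
    private
      f : ℕ → List Entry
      f i = prefix ℓ (rowOf Π i)

    peel-stacked : ∀ i → Stacked (f i) (f (suc i))
    peel-stacked i = prefix-stacked (RowOver.letters (rows t (suc i))) (stacked t i)

    peel-decr : Decreasing (length ∘ f)
    peel-decr i = stacked-length (peel-stacked i)

    peel-zero : f (length Π) ≡ []
    peel-zero = cong (prefix ℓ) (at-≥length Π ≤-refl)

  peel : Filling → Filling
  peel Π = Rows.build (length Π) (λ i → prefix ℓ (rowOf Π i))

  peelShape : (Π : Filling) → .(Tableau (ℓ ∷ w) Π) → Partition
  peelShape Π t = fromRows (length Π) (λ i → length (prefix ℓ (rowOf Π i)))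
    (peel-decr Π t) (cong length (peel-zero Π t))

  rowOf-peel : ∀ Π → Tableau (ℓ ∷ w) Π → ∀ i → rowOf (peel Π) i ≡ prefix ℓ (rowOf Π i)
  rowOf-peel Π t = Rows.at-build (length Π) _ (shrinks⇒vanishing (peel-decr Π t)) (peel-zero Π t)

  row-peelShape : ∀ Π .(t : Tableau (ℓ ∷ w) Π) i → row (peelShape Π t) i ≡ length (prefix ℓ (rowOf Π i))
  row-peelShape Π t = row-fromRows (length Π) _ (peel-decr Π t) (cong length (peel-zero Π t))

  peel-tableau : ∀ Π → Tableau (ℓ ∷ w) Π → Tableau w (peel Π)
  peel-tableau Π t = record
    { proper  = Rows.build-proper (length Π) _
    ; rows    = λ i → subst (RowOver w) (sym (rowOf-peel Π t i)) (prefix-row (rows t i))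
    ; stacked = λ i → subst₂ Stacked (sym (rowOf-peel Π t i)) (sym (rowOf-peel Π t (suc i)))
                        (peel-stacked Π t i) }

  peel-hasShape : ∀ Π (t : Tableau (ℓ ∷ w) Π) → HasShape (peelShape Π t) (peel Π)
  peel-hasShape Π t i = trans (cong length (rowOf-peel Π t i)) (sym (row-peelShape Π t i))

  peel-strip : ∀ γ Π (t : Tableau (ℓ ∷ w) Π) → HasShape γ Π → Strip (over ℓ) (row γ) (row (peelShape Π t))
  peel-strip γ Π t h = strip-resp (over ℓ) h (λ i → sym (row-peelShape Π t i)) (lengths (over ℓ) refl)
    where
    lengths : ∀ κ → over ℓ ≡ κ → Strip κ (length ∘ rowOf Π) (λ i → length (prefix ℓ (rowOf Π i)))
    lengths true  e i = prefix-length (rowOf Π i) , row-vertical e (rows t i)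
    lengths false e i = prefix-length (rowOf Π i) ,
      stacked-horizontal e (RowOver.letters (rows t (suc i))) (stacked t i)

  grow : Partition → Filling → Filling
  grow γ Π = Rows.build (len γ) (λ i → extend ℓ (rowOf Π i) (row γ i))

  module _ (γ μ : Partition) (s : Strip (over ℓ) (row γ) (row μ))
           (Π : Filling) (t : Tableau w Π) (h : HasShape μ Π) where
    private
      f : ℕ → List Entry
      f i = extend ℓ (rowOf Π i) (row γ i)

    inner≤ : ∀ i → length (rowOf Π i) ≤ row γ i
    inner≤ i = ≤-trans (≤-reflexive (h i)) (strip-⊆ (over ℓ) s i)

    total-length : ∀ i → length (rowOf Π i) + (row γ i ∸ length (rowOf Π i)) ≡ row γ i
    total-length i = m+[n∸m]≡n (inner≤ i)

    extend-length : ∀ i → length (f i) ≡ row γ i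
    extend-length i = trans (length-++ (rowOf Π i)) (trans
      (cong (length (rowOf Π i) +_) (length-replicate (row γ i ∸ length (rowOf Π i)))) (total-length i))

    grow-decr : Decreasing (length ∘ f)
    grow-decr i = subst₂ _≤_ (sym (extend-length (suc i))) (sym (extend-length i)) (row-decr γ i)

    rowOf-grow : ∀ i → rowOf (grow γ Π) i ≡ extend ℓ (rowOf Π i) (row γ i)
    rowOf-grow = Rows.at-build (len γ) f (shrinks⇒vanishing grow-decr)
      (length≡0 (trans (extend-length (len γ)) (row-≥len γ ≤-refl)))

    grow-hasShape : HasShape γ (grow γ Π)
    grow-hasShape i = trans (cong length (rowOf-grow i)) (extend-length i)

    at-most-one : over ℓ ≡ true → ∀ i → row γ i ∸ length (rowOf Π i) ≤ 1
    at-most-one e i = m≤n+o⇒m∸n≤o _ _ (≤-trans (proj₂ (vertical i))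
      (≤-reflexive (trans (cong suc (sym (h i))) (+-comm 1 (length (rowOf Π i))))))
      where
      vertical : VStrip (row γ) (row μ)
      vertical = subst (λ κ → Strip κ (row γ) (row μ)) e s

    interlaces : over ℓ ≡ false → ∀ i → row γ (suc i) ≤ length (rowOf Π i)
    interlaces e i = ≤-trans (proj₂ (horizontal i)) (≤-reflexive (sym (h i)))
      where
      horizontal : HStrip (row γ) (row μ)
      horizontal = subst (λ κ → Strip κ (row γ) (row μ)) e s

    grow-tableau : Tableau (ℓ ∷ w) (grow γ Π)
    grow-tableau = record
      { proper  = Rows.build-proper (len γ) f
      ; rows    = λ i → subst (RowOver (ℓ ∷ w)) (sym (rowOf-grow i))
                    (row-++ _ (λ e → at-most-one e i) (rows t i))
      ; stacked = λ i → subst₂ Stacked (sym (rowOf-grow i)) (sym (rowOf-grow (suc i)))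
          (stacked-++ _ _ (RowOver.letters (rows t i)) (stacked t i)
            (subst₂ _≤_ (sym (total-length (suc i))) (sym (total-length i)) (row-decr γ i))
            (λ e → ≤-trans (≤-reflexive (total-length (suc i))) (interlaces e i))) }

    prefix-grow : ∀ i → prefix ℓ (rowOf (grow γ Π) i) ≡ rowOf Π i
    prefix-grow i = trans (cong (prefix ℓ) (rowOf-grow i))
      (prefix-++ (row γ i ∸ length (rowOf Π i)) (RowOver.letters (rows t i)))

    peel-grow : peel (grow γ Π) ≡ Π
    peel-grow = Rows.at-ext (Rows.build-proper (length (grow γ Π)) _) (proper t)
      λ i → trans (rowOf-peel (grow γ Π) grow-tableau i) (prefix-grow i)

    peelShape-grow : ∀ i → row (peelShape (grow γ Π) grow-tableau) i ≡ row μ i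
    peelShape-grow i = trans (row-peelShape (grow γ Π) grow-tableau i)
      (trans (cong length (prefix-grow i)) (h i))

  module _ (γ : Partition) (Π : Filling) (t : Tableau (ℓ ∷ w) Π) (h : HasShape γ Π) where

    extend-peel : ∀ i → extend ℓ (rowOf (peel Π) i) (row γ i) ≡ rowOf Π i
    extend-peel i = trans (cong₂ (extend ℓ) (rowOf-peel Π t i) (sym (h i))) (extend-prefix (rows t i))

    grow-peel : grow γ (peel Π) ≡ Π
    grow-peel = Rows.at-ext (Rows.build-proper (len γ) _) (proper t) λ i →
      trans (rowOf-grow γ (peelShape Π t) (peel-strip γ Π t h) (peel Π) (peel-tableau Π t) (peel-hasShape Π t) i)
            (extend-peel i)

    -- An arbitrary statistic on entries covers both components of the weight: it is used for the
    -- indicator of an overline and for the value.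
    entrySum-peel : ∀ f → f ℓ * (size γ ∸ size (peelShape Π t)) + entrySum f (peel Π) ≡ entrySum f Π
    entrySum-peel f = begin
      f ℓ * (size γ ∸ size μ) + entrySum f (peel Π)
        ≡⟨ cong₂ (λ s e → f ℓ * s + e) (cong₂ _∸_ (size-Σ γ lγ) (size-Σ μ lμ)) (entrySum-Σ f (peel Π) lp) ⟩
      f ℓ * (Σ< N (row γ) ∸ Σ< N (row μ)) + Σ< N (λ i → sum (map f (rowOf (peel Π) i)))
        ≡⟨ cong (_+ Σ< N (λ i → sum (map f (rowOf (peel Π) i))))
             (trans (cong (f ℓ *_) (sym (Σ<-∸ N (strip-⊆ (over ℓ) (peel-strip γ Π t h)))))
               (sym (Σ<-* N (f ℓ) _))) ⟩
      Σ< N (λ i → f ℓ * (row γ i ∸ row μ i)) + Σ< N (λ i → sum (map f (rowOf (peel Π) i)))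
        ≡⟨ Σ<-+ N _ _ ⟨
      Σ< N (λ i → f ℓ * (row γ i ∸ row μ i) + sum (map f (rowOf (peel Π) i)))
        ≡⟨ Σ<-cong N (λ i → trans
             (cong (λ n → f ℓ * (row γ i ∸ n) + sum (map f (rowOf (peel Π) i))) (sym (peel-hasShape Π t i)))
             (trans (sym (sum-extend f ℓ (rowOf (peel Π) i) (row γ i)))
               (cong (λ r → sum (map f r)) (extend-peel i)))) ⟩
      Σ< N (λ i → sum (map f (rowOf Π i)))
        ≡⟨ entrySum-Σ f Π lΠ ⟨
      entrySum f Π ∎
      where
      open ≡-Reasoning
      μ = peelShape Π t
      N = (len γ + len μ) + (length Π + length (peel Π))
      lγ : len γ ≤ N
      lγ = ≤-trans (m≤m+n (len γ) (len μ)) (m≤m+n _ _)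
      lμ : len μ ≤ N
      lμ = ≤-trans (m≤n+m (len μ) (len γ)) (m≤m+n _ _)
      lΠ : length Π ≤ N
      lΠ = ≤-trans (m≤m+n (length Π) (length (peel Π))) (m≤n+m _ (len γ + len μ))
      lp : length (peel Π) ≤ N
      lp = ≤-trans (m≤n+m _ (length Π)) (m≤n+m _ (len γ + len μ))

  peeled-≡ : ∀ {γ μ μ′ Π Π′} 
    {s : Irrelevant (Strip (over ℓ) (row γ) (row μ))}
    {s′ : Irrelevant (Strip (over ℓ) (row γ) (row μ′))}
    {t : Irrelevant (Tableau w Π × HasShape μ Π)}
    {t′ : Irrelevant (Tableau w Π′ × HasShape μ′ Π′)} →
    μ ≡ μ′ → Π ≡ Π′ →
    _≡_ {A = Carrier (⨆[ μ ∈ Partition ] (StripClass ℓ γ μ ⊗ TableauxOf w μ))}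
      (μ , s , (Π , t)) (μ′ , s′ , (Π′ , t′))
  peeled-≡ refl refl = refl

  peel-≅ : ∀ γ → TableauxOf (ℓ ∷ w) γ ≅ ⨆[ μ ∈ Partition ] (StripClass ℓ γ μ ⊗ TableauxOf w μ)
  peel-≅ γ = record
    { to      = λ (Π , [ th ]) →
        peelShape Π (proj₁ th) , [ peel-strip γ Π (proj₁ th) (proj₂ th) ] ,
        (peel Π , [ (peel-tableau Π (proj₁ th) , peel-hasShape Π (proj₁ th)) ])
    ; from    = λ (μ , [ s ] , (Π , [ th ])) →
        grow γ Π , [ (grow-tableau γ μ s Π (proj₁ th) (proj₂ th)
                   , grow-hasShape γ μ s Π (proj₁ th) (proj₂ th)) ]
    ; to-from = λ (μ , [ s ] , (Π , [ th ])) → peeled-≡ {γ}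
        (row-ext (peelShape (grow γ Π) (grow-tableau γ μ s Π (proj₁ th) (proj₂ th))) μ λ i →
          recompute (_ ≟ _) (peelShape-grow γ μ s Π (proj₁ th) (proj₂ th) i))
        (recompute (_ ≟ᶠ _) (peel-grow γ μ s Π (proj₁ th) (proj₂ th)))
    ; from-to = λ (Π , [ th ]) → refinement-≡ (recompute (_ ≟ᶠ _) (grow-peel γ Π (proj₁ th) (proj₂ th)))
    ; wt-to   = λ (Π , [ th ]) → cong₂ _,_
        (recompute (_ ≟ _) (entrySum-peel γ Π (proj₁ th) (proj₂ th) (λ e → if over e then 1 else 0)))
        (recompute (_ ≟ _) (entrySum-peel γ Π (proj₁ th) (proj₂ th) val))
    }

data Descending : List Entry → Set where
  []  : Descending []
  _∷_ : ∀ {ℓ w} → All (_≺ ℓ) w → Descending w → Descending (ℓ ∷ w)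

empty-tableau : ∀ {Π} → Tableau [] Π → Π ≡ []
empty-tableau {[]}    t = refl
empty-tableau {r ∷ Π} t with proper t | rows t 0
... | p ∷ _ | (_ , [])       = contradiction refl p
... | p ∷ _ | (_ , (() ∷ _))

tableauxOf-chain : ∀ {w} → Descending w → ∀ γ → TableauxOf w γ ≅ Chain w γ
tableauxOf-chain [] γ = record
  { to      = λ (Π , [ th ]) → [ (λ i → trans (sym (proj₂ th i))
                                   (cong (λ Π → length (rowOf Π i)) (empty-tableau (proj₁ th)))) ]
  ; from    = λ ([ e ]) → [] , [ (record { proper = [] ; rows = λ _ → [] , [] ; stacked = λ _ → [] }
                                 , λ i → sym (e i)) ]
  ; to-from = λ _ → refl
  ; from-to = λ (Π , [ th ]) → refinement-≡ (sym (recompute (Π ≟ᶠ []) (empty-tableau (proj₁ th))))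
  ; wt-to   = λ (Π , [ th ]) → cong fillingWt (sym (recompute (Π ≟ᶠ []) (empty-tableau (proj₁ th))))
  }
tableauxOf-chain {ℓ ∷ w} (last ∷ d) γ = ≅-trans (PeelTableau.peel-≅ ℓ w last γ)
  (⨆-cong λ μ → ⊗-congʳ (StripClass ℓ γ μ) (tableauxOf-chain d μ))

shape : ∀ {w} (Π : Filling) → .(Tableau w Π) → Partition
shape Π t = fromRows (length Π) (length ∘ rowOf Π) (λ i → stacked-length (stacked t i))
              (cong length (at-≥length Π ≤-refl))

row-shape : ∀ {w} Π .(t : Tableau w Π) i → row (shape Π t) i ≡ length (rowOf Π i)
row-shape Π t = row-fromRows (length Π) _ (λ i → stacked-length (stacked t i))
                  (cong length (at-≥length Π ≤-refl))

tableaux-byShape : ∀ w → Tableaux w ≅ ⨆ Partition (TableauxOf w)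
tableaux-byShape w = record
  { to      = λ (Π , [ t ]) → shape Π t , (Π , [ (t , λ i → sym (row-shape Π t i)) ])
  ; from    = λ (γ , (Π , [ th ])) → Π , [ proj₁ th ]
  ; to-from = λ (γ , (Π , [ th ])) → sameShape
      (row-ext (shape Π (proj₁ th)) γ λ i →
        recompute (_ ≟ _) (trans (row-shape Π (proj₁ th) i) (proj₂ th i)))
  ; from-to = λ _ → refl
  ; wt-to   = λ _ → refl
  }
  where
  sameShape : ∀ {γ γ′ Π} {t : Irrelevant (Tableau w Π × HasShape γ Π)}
    {t′ : Irrelevant (Tableau w Π × HasShape γ′ Π)} →
    γ ≡ γ′ → _≡_ {A = Carrier (⨆ Partition (TableauxOf w))} (γ , (Π , t)) (γ′ , (Π , t′))
  sameShape refl = refl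

tableaux-chains : ∀ {w} → Descending w → Tableaux w ≅ Chains w
tableaux-chains {w} d = ≅-trans (tableaux-byShape w) (⨆-cong (tableauxOf-chain d))

-- Plane overpartitions as tableaux

∧⇒ : ∀ {x y} → T (x ∧ y) → T x × T y
∧⇒ = Equivalence.to T-∧

∧⇐ : ∀ {x y} → T x → T y → T (x ∧ y)
∧⇐ p q = Equivalence.from T-∧ (p , q)

≡⇒T : ∀ {x} → x ≡ true → T x
≡⇒T = Equivalence.from T-≡

T⇒≡ : ∀ {x} → T x → x ≡ true
T⇒≡ = Equivalence.to T-≡

allᵇ⇒ : ∀ {A : Set} (p : A → Bool) xs → T (allᵇ p xs) → All (T ∘ p) xs
allᵇ⇒ p []       t = []
allᵇ⇒ p (x ∷ xs) t = proj₁ (∧⇒ t) ∷ allᵇ⇒ p xs (proj₂ (∧⇒ t))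

allᵇ⇐ : ∀ {A : Set} {p : A → Bool} {xs} → All (T ∘ p) xs → T (allᵇ p xs)
allᵇ⇐ []       = tt
allᵇ⇐ (t ∷ ts) = ∧⇐ t (allᵇ⇐ ts)

All-at : ∀ {A : Set} {d : A} {P : A → Set} {xs} → All P xs → P d → ∀ i → P (at d xs i)
All-at []       q i       = q
All-at (p ∷ ps) q zero    = p
All-at (p ∷ ps) q (suc i) = All-at ps q i

at-All : ∀ {A : Set} {d : A} {P : A → Set} xs → (∀ i → P (at d xs i)) → All P xs
at-All []       h = []
at-All (x ∷ xs) h = h 0 ∷ at-All xs (h ∘ suc)

elem-above : ∀ {v vs} → All (v <_) vs → elemᵇ v vs ≡ false
elem-above []                       = refl
elem-above {v} {u ∷ vs} (l ∷ ls) with v ≡ᵇ u in e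
... | true  = contradiction (≡ᵇ⇒≡ v u (≡⇒T e)) (<⇒≢ l)
... | false = elem-above ls

elem-below : ∀ {v vs} → All (_< v) vs → elemᵇ v vs ≡ false
elem-below []                       = refl
elem-below {v} {u ∷ vs} (l ∷ ls) with v ≡ᵇ u in e
... | true  = contradiction (sym (≡ᵇ⇒≡ v u (≡⇒T e))) (<⇒≢ l)
... | false = elem-below ls

rowRel⇒≤ : ∀ {x y} → RowRel x y → val y ≤ val x
rowRel⇒≤ (inj₁ l)       = <⇒≤ l
rowRel⇒≤ (inj₂ (e , _)) = ≤-reflexive e

rowRel⇒< : ∀ {x y} → over x ≡ true → RowRel x y → val y < val x
rowRel⇒< t (inj₁ l)       = l
rowRel⇒< t (inj₂ (_ , f)) = contradiction (trans (sym t) f) λ ()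

rowDecr⇐ : ∀ {r} → AllPairs RowRel r → T (rowDecr r)
rowDecr⇐ []                     = tt
rowDecr⇐ (_ ∷ [])               = tt
rowDecr⇐ {x ∷ y ∷ _} ((p ∷ _) ∷ (ps ∷ pss)) = ∧⇐ (≤⇒≤ᵇ (rowRel⇒≤ {x} {y} p)) (rowDecr⇐ (ps ∷ pss))

rowOverOK⇐ : ∀ {r} → AllPairs RowRel r → T (rowOverOK r)
rowOverOK⇐ []                 = tt
rowOverOK⇐ {x ∷ r} (ps ∷ pss) = ∧⇐ (head (over x) refl) (rowOverOK⇐ pss)
  where
  vals : over x ≡ true → ∀ {r} → All (RowRel x) r → All (_< val x) (map val r)
  vals t []       = []
  vals t {y ∷ _} (p ∷ ps) = rowRel⇒< {x} {y} t p ∷ vals t ps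
  head : ∀ b → over x ≡ b → T (not b ∨ not (elemᵇ (val x) (map val r)))
  head false e = tt
  head true  e = subst (T ∘ not) (sym (elem-below (vals e ps))) tt

rowDecr-head : ∀ x r → T (rowDecr (x ∷ r)) → All (λ y → val y ≤ val x) r
rowDecr-head x []      t = []
rowDecr-head x (y ∷ r) t = let (l , t′) = ∧⇒ t ; y≤x = ≤ᵇ⇒≤ (val y) (val x) l in
  y≤x ∷ All.map (λ z≤y → ≤-trans z≤y y≤x) (rowDecr-head y r t′)

rowDecr-tail : ∀ x r → T (rowDecr (x ∷ r)) → T (rowDecr r)
rowDecr-tail x []      t = tt
rowDecr-tail x (y ∷ r) t = proj₂ (∧⇒ t)

-- After an overlined entry, weak decrease and the absence of its value further right combine to
-- strict decrease; after any other entry, equality is admissible.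
row⇒ : ∀ r → T (rowDecr r) → T (rowOverOK r) → AllPairs RowRel r
row⇒ []      d o = []
row⇒ (x ∷ r) d o = head (over x) refl (rowDecr-head x r d) (proj₁ (∧⇒ o)) ∷
  row⇒ r (rowDecr-tail x r d) (proj₂ (∧⇒ o))
  where
  distinct : over x ≡ true → ∀ {r} → All (λ y → val y ≤ val x) r →
    T (not (elemᵇ (val x) (map val r))) → All (RowRel x) r
  distinct e []                 t = []
  distinct e {y ∷ r} (l ∷ ls) t with val x ≡ᵇ val y in e′
  ... | false = inj₁ (≤∧≢⇒< l λ eq → subst T e′ (≡⇒≡ᵇ (val x) (val y) (sym eq))) ∷ distinct e ls t
  head : ∀ b → over x ≡ b → All (λ y → val y ≤ val x) r →
    T (not b ∨ not (elemᵇ (val x) (map val r))) → All (RowRel x) r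
  head true  e ls t = distinct e ls t
  head false e ls t = All.map (λ l → [ inj₁ , (λ eq → inj₂ (eq , e)) ]′ (m≤n⇒m<n∨m≡n l)) ls

colRel⇒≤ : ∀ {x y} → ColRel x y → val y ≤ val x
colRel⇒≤ (inj₁ l)       = <⇒≤ l
colRel⇒≤ (inj₂ (e , _)) = ≤-reflexive e

zipDecr : List Entry → List Entry → Bool
zipDecr r s = allᵇ (λ p → val (proj₂ p) ≤ᵇ val (proj₁ p)) (zip r s)

stacked⇐ : ∀ r s → length s ≤ length r → T (zipDecr r s) →
  (∀ j {x y} → nth j r ≡ just x → nth j s ≡ just y → val y ≡ val x → over y ≡ true) → Stacked r s
stacked⇐ r       []      l       t h = []
stacked⇐ (x ∷ r) (y ∷ s) (s≤s l) t h =
  [ inj₁ , (λ e → inj₂ (e , h 0 refl refl e)) ]′ (m≤n⇒m<n∨m≡n (≤ᵇ⇒≤ (val y) (val x) (proj₁ (∧⇒ t))))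
  ∷ stacked⇐ r s l (proj₂ (∧⇒ t)) (λ j → h (suc j))

stacked⇒zipDecr : ∀ {r s} → Stacked r s → T (zipDecr r s)
stacked⇒zipDecr {[]}    []       = tt
stacked⇒zipDecr {_ ∷ _} []       = tt
stacked⇒zipDecr {x ∷ _} (c ∷ cs) = ∧⇐ (≤⇒≤ᵇ (colRel⇒≤ {x} c)) (stacked⇒zipDecr cs)

stacked-nth : ∀ {r s} → Stacked r s → ∀ j {x y} → nth j r ≡ just x → nth j s ≡ just y → ColRel x y
stacked-nth (c ∷ cs) zero    refl refl = c
stacked-nth (c ∷ cs) (suc j) p    q    = stacked-nth cs j p q

stacked-nothing : ∀ {r s} → Stacked r s → ∀ j → nth j r ≡ nothing → nth j s ≡ nothing
stacked-nothing []       j       p = refl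
stacked-nothing (c ∷ cs) (suc j) p = stacked-nothing cs j p

nth-< : ∀ {A : Set} j (xs : List A) {x} → nth j xs ≡ just x → j < length xs
nth-< zero    (x ∷ xs) e = s≤s z≤n
nth-< (suc j) (x ∷ xs) e = s≤s (nth-< j xs e)

column-just : ∀ j r Π {x} → nth j r ≡ just x → column j (r ∷ Π) ≡ x ∷ column j Π
column-just j r Π e with nth j r
column-just j r Π refl | just x = refl

column-nothing : ∀ j r Π → nth j r ≡ nothing → column j (r ∷ Π) ≡ column j Π
column-nothing j r Π e with nth j r
column-nothing j r Π refl | nothing = refl

-- The list of seen values is left open because dropping the top row moves its values there, and `W`
-- stays fixed while the remaining rows get shorter.
ColumnsOK : ℕ → Filling → Set
ColumnsOK W Π = ∀ j → j < W → ∃ λ seen → T (colOverOK seen (column j Π))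

columnsOK-tail : ∀ {W} r Π → ColumnsOK W (r ∷ Π) → ColumnsOK W Π
columnsOK-tail r Π h j l with h j l
... | seen , t with nth j r
... | just x  = val x ∷ seen , proj₂ (∧⇒ t)
... | nothing = seen , t

columns-over : ∀ {W} r s Π → ColumnsOK W (r ∷ s ∷ Π) → length r ≤ W →
  ∀ j {x y} → nth j r ≡ just x → nth j s ≡ just y → val y ≡ val x → over y ≡ true
columns-over r s Π h l j {x} {y} p q e with h j (≤-trans (nth-< j r p) l)
-- When `y` is tested, the value of `x` has just become the head of the seen values, so equality
-- forces the overline.
... | seen , t rewrite column-just j r (s ∷ Π) p | column-just j s Π q =
  T⇒≡ (forced (proj₁ (∧⇒ (proj₂ (∧⇒ {not (elemᵇ (val x) seen) ∨ over x} t)))))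
  where
  forced : ∀ {b} → T (not ((val y ≡ᵇ val x) ∨ elemᵇ (val y) seen) ∨ b) → T b
  forced t rewrite T⇒≡ (≡⇒≡ᵇ (val y) (val x) e) = t

filling-stacked : ∀ {W} Π → T (shapeOK Π) → T (colDecr Π) → width Π ≤ W → ColumnsOK W Π →
  ∀ i → Stacked (rowOf Π i) (rowOf Π (suc i))
filling-stacked []          s d l h i    = []
filling-stacked (r ∷ [])    s d l h i    = []
filling-stacked (r ∷ s ∷ Π) S d l h i with ∧⇒ (proj₂ (∧⇒ {not (null r)} S))
... | (s≤r , S′) with ≤ᵇ⇒≤ (length s) (length r) s≤r | ∧⇒ {zipDecr r s} d
filling-stacked (r ∷ s ∷ Π) S d l h zero    | _ , S′ | s≤r | z , d′ =
  stacked⇐ r s s≤r z (columns-over r s Π h l)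
filling-stacked (r ∷ s ∷ Π) S d l h (suc i) | _ , S′ | s≤r | z , d′ =
  filling-stacked (s ∷ Π) S′ d′ (≤-trans s≤r l) (columnsOK-tail r (s ∷ Π) h) i

shapeOK⇒proper : ∀ Π → T (shapeOK Π) → Rows.Proper Π
shapeOK⇒proper []                t = []
shapeOK⇒proper ((x ∷ r) ∷ [])    t = (λ ()) ∷ []
shapeOK⇒proper ((x ∷ r) ∷ s ∷ Π) t = (λ ()) ∷ shapeOK⇒proper (s ∷ Π) (proj₂ (∧⇒ {length s ≤ᵇ suc (length r)} t))

StackedRows : Filling → Set
StackedRows Π = ∀ i → Stacked (rowOf Π i) (rowOf Π (suc i))

shapeOK⇐ : ∀ {Π} → Rows.Proper Π → StackedRows Π → T (shapeOK Π)
shapeOK⇐ {[]}               []       h = tt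
shapeOK⇐ {[] ∷ Π}           (p ∷ _)  h = contradiction refl p
shapeOK⇐ {(x ∷ r) ∷ []}     (p ∷ ps) h = tt
shapeOK⇐ {(x ∷ r) ∷ s ∷ Π}  (p ∷ ps) h =
  ∧⇐ {length s ≤ᵇ suc (length r)} (≤⇒≤ᵇ (stacked-length (h 0))) (shapeOK⇐ ps (h ∘ suc))

colDecr⇐ : ∀ Π → StackedRows Π → T (colDecr Π)
colDecr⇐ []          h = tt
colDecr⇐ (r ∷ [])    h = tt
colDecr⇐ (r ∷ s ∷ Π) h = ∧⇐ (stacked⇒zipDecr (h 0)) (colDecr⇐ (s ∷ Π) (h ∘ suc))

-- `column` skips rows that are too short. Row lengths decrease, so a column that has stopped does
-- not resume further down.
column-empty : ∀ j r Π → StackedRows (r ∷ Π) → nth j r ≡ nothing → column j Π ≡ []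
column-empty j r []      h e = refl
column-empty j r (s ∷ Π) h e = let e′ = stacked-nothing (h 0) j e in
  trans (column-nothing j s Π e′) (column-empty j s Π (h ∘ suc) e′)

-- The invariant is that every seen value is at least that of the entry just above. A strictly
-- smaller value below it is then new, and an equal one is overlined by `ColRel`.
column-over : ∀ j r Π {x seen} → StackedRows (r ∷ Π) → nth j r ≡ just x → All (val x ≤_) seen →
  T (colOverOK (val x ∷ seen) (column j Π))
column-over j r []      h e b = tt
column-over j r (s ∷ Π) {x} {seen} h e b with nth j s in e′
... | nothing = subst (T ∘ colOverOK (val x ∷ seen)) (sym (column-empty j s Π (h ∘ suc) e′)) tt
... | just y  = ∧⇐ (head c) (column-over j s Π (h ∘ suc) e′ (All.map (≤-trans (colRel⇒≤ {x} c)) (≤-refl ∷ b)))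
  where
  c : ColRel x y
  c = stacked-nth (h 0) j e e′
  head : ColRel x y → T (not (elemᵇ (val y) (val x ∷ seen)) ∨ over y)
  head (inj₁ l)       = subst (λ b → T (not b ∨ over y))
    (sym (elem-above {val y} {val x ∷ seen} (l ∷ All.map (<-≤-trans l) b))) tt
  head (inj₂ (_ , t)) = Equivalence.from T-∨ (inj₂ (≡⇒T t))

columns⇐ : ∀ Π → StackedRows Π → ∀ j → T (colOverOK [] (column j Π))
columns⇐ []      h j = tt
columns⇐ (r ∷ Π) h j with nth j r in e
... | nothing = subst (T ∘ colOverOK []) (sym (column-empty j r Π h e)) tt
... | just x  = column-over j r Π h e []

-- The alphabet up to n and the final correspondence

∈-word⁺ : ∀ {v xs} o → v ∈ xs → (v , o) ∈ word xs
∈-word⁺ true  (here refl) = here refl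
∈-word⁺ false (here refl) = there (here refl)
∈-word⁺ o     (there p)   = there (there (∈-word⁺ o p))

∈-word⁻ : ∀ {e} xs → e ∈ word xs → val e ∈ xs
∈-word⁻ (x ∷ xs) (here refl)         = here refl
∈-word⁻ (x ∷ xs) (there (here refl)) = here refl
∈-word⁻ (x ∷ xs) (there (there p))   = there (∈-word⁻ xs p)

∈-oneTo⁺ : ∀ {v n} → 1 ≤ v → v ≤ n → v ∈ oneTo n
∈-oneTo⁺ {suc v} _ l = ∈-map⁺ suc (∈-upTo⁺ l)

∈-oneTo⁻ : ∀ {v n} → v ∈ oneTo n → 1 ≤ v × v ≤ n
∈-oneTo⁻ p with ∈-map⁻ suc p
... | i , q , refl = s≤s z≤n , ∈-upTo⁻ q

word-All : ∀ {P : Entry → Set} {xs} → All (λ v → ∀ o → P (v , o)) xs → All P (word xs)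
word-All []       = []
word-All (p ∷ ps) = p true ∷ p false ∷ word-All ps

word-descending : ∀ {xs} → AllPairs _<_ xs → Descending (word xs)
word-descending []       = []
word-descending {x ∷ xs} (p ∷ ps) =
  (inj₂ (refl , refl , refl) ∷ larger true) ∷ (larger false ∷ word-descending ps)
  where
  larger : ∀ o → All (_≺ (x , o)) (word xs)
  larger o = word-All (All.map (λ l _ → inj₁ l) p)

oneTo-increasing : ∀ n → AllPairs _<_ (oneTo n)
oneTo-increasing n = subst (AllPairs _<_) (sym (map-upTo suc n))
  (applyUpTo⁺₁ suc n (λ i<j _ → s≤s i<j))

module _ (n : ℕ) where
  private
    w = word (oneTo n)

  filling⇒tableau : ∀ Π → T (isPlaneOverpartition Π) → T (boundedBy n Π) → Tableau w Π
  filling⇒tableau Π t b with ∧⇒ {shapeOK Π} t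
  ... | S , t₁ with ∧⇒ {positive Π} t₁
  ... | P , t₂ with ∧⇒ {allᵇ rowDecr Π} t₂
  ... | R , t₃ with ∧⇒ {colDecr Π} t₃
  ... | D , t₄ with ∧⇒ {allᵇ rowOverOK Π} t₄
  ... | O , C = record
    { proper  = shapeOK⇒proper Π S
    ; rows    = All-at (allRows Π P R O b) ([] , [])
    ; stacked = filling-stacked Π S D ≤-refl λ j l →
        [] , All.lookup (allᵇ⇒ (λ j → colOverOK [] (column j Π)) (upTo (width Π)) C) (∈-upTo⁺ l) }
    where
    entries : ∀ r → T (allᵇ (λ e → 1 ≤ᵇ val e) r) → T (allᵇ (λ e → val e ≤ᵇ n) r) → All (_∈ w) r
    entries []      p q = []
    entries (e ∷ r) p q = ∈-word⁺ (over e)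
      (∈-oneTo⁺ (≤ᵇ⇒≤ 1 (val e) (proj₁ (∧⇒ p))) (≤ᵇ⇒≤ (val e) n (proj₁ (∧⇒ q))))
      ∷ entries r (proj₂ (∧⇒ {1 ≤ᵇ val e} p)) (proj₂ (∧⇒ q))
    allRows : ∀ Π → T (positive Π) → T (allᵇ rowDecr Π) → T (allᵇ rowOverOK Π) → T (boundedBy n Π) →
      All (RowOver w) Π
    allRows []      P R O B = []
    allRows (r ∷ Π) P R O B with ∧⇒ P | ∧⇒ R | ∧⇒ O | ∧⇒ B
    ... | p , P′ | d , R′ | o , O′ | b , B′ = (row⇒ r d o , entries r p b) ∷ allRows Π P′ R′ O′ B′

  module _ {Π} (t : Tableau w Π) where
    rows-All : ∀ {p : List Entry → Bool} → (∀ {r} → RowOver w r → T (p r)) → T (allᵇ p Π)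
    rows-All h = allᵇ⇐ (All.map h (at-All Π (rows t)))

    letters-All : ∀ {p : Entry → Bool} → (∀ e → 1 ≤ val e × val e ≤ n → T (p e)) → T (allᵇ (allᵇ p) Π)
    letters-All h = rows-All λ ρ →
      allᵇ⇐ (All.map (λ {e} i → h e (∈-oneTo⁻ (∈-word⁻ (oneTo n) i))) (RowOver.letters ρ))

    tableau⇒plane : T (isPlaneOverpartition Π)
    tableau⇒plane = ∧⇐ (shapeOK⇐ (proper t) (stacked t)) (∧⇐ (letters-All (λ _ → ≤⇒≤ᵇ ∘ proj₁))
      (∧⇐ (rows-All (rowDecr⇐ ∘ RowOver.sorted)) (∧⇐ (colDecr⇐ Π (stacked t))
        (∧⇐ (rows-All (rowOverOK⇐ ∘ RowOver.sorted))
          (allᵇ⇐ (All.universal (columns⇐ Π (stacked t)) (upTo (width Π))))))))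

    tableau⇒bounded : T (boundedBy n Π)
    tableau⇒bounded = letters-All (λ _ → ≤⇒≤ᵇ ∘ proj₂)

  -- All components of `L n m k` other than the filling are propositions, so both inverse laws hold
  -- once the filling is left unchanged.
  fiber-L : ∀ m k → Fiber (Tableaux w) (m , k) ↔ L n m k
  fiber-L m k = mk↔ₛ′ to from to-from (λ _ → fiber-≡ {Tableaux w} refl)
    where
    to : Fiber (Tableaux w) (m , k) → L n m k
    to ((Π , [ t ]) , p) = Π , recompute (T? _) (tableau⇒plane t) , recompute (T? _) (tableau⇒bounded t)
                             , cong proj₁ p , cong proj₂ p
    from : L n m k → Fiber (Tableaux w) (m , k)
    from (Π , p , b , e , f) = (Π , [ filling⇒tableau Π p b ]) , cong₂ _,_ e f
    to-from : ∀ x → to (from x) ≡ x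
    to-from (Π , p , b , e , f) = cong (Π ,_) (cong₂ _,_ (T-irrelevant _ p) (cong₂ _,_ (T-irrelevant _ b)
      (cong₂ _,_ (≡-irrelevant _ e) (≡-irrelevant _ f))))

theorem6 : (n : ℕ) → 1 ≤ n → (m k : ℕ) → Fin (rhs n m k) ↔ L n m k
theorem6 n _ m k = ↔-trans (rhs-enumerates n m k)
  (↔-trans (fiber-≅ rhs≅tableaux (m , k)) (fiber-L n m k))
  where
  w = word (oneTo n)
  rhs≅tableaux : rhsClass n ≅ Tableaux w
  rhs≅tableaux = ≅-trans (rhsClass-expansion n) (≅-sym
    (≅-trans (tableaux-chains (word-descending (oneTo-increasing n))) (chains-expansion w)))
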